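{- Let $q$ be an odd prime power, let $\zeta$ be a generator of $\mathbf{F}_{q^2}^\times$, let $\rho$ be an element of $\mathbf{F}_{q^2}\setminus\mathbf{F}_q$ with $\rho^2\in\mathbf{F}_q$, and let $\nu=\rho^2$. Let \[S_{22}=\{\rho(\zeta^i-1)/(\zeta^i+1) \mid 0<i\le (q-1)/2\}\] and let $T_{22}$ be the set of homogenized minimal polynomials over $\mathbf{F}_q$ of the elements of $S_{22}$. Then the set $\{(x^2-\nu y^2)g \mid g\in T_{22}\}$ is a complete set of unique representatives for the action of $\mathrm{PGL}_2(\mathbf{F}_q)$ on the homogeneous quartics in $\mathbf{F}_q[x,y]$ that factor into a product of two distinct monic irreducible quadratics.
   Context: For a finite field $k$, a homogeneous polynomial $f\in k[x,y]$ is called monic if $f(x,1)$ is monic. $\mathrm{PGL}_2(k)$ acts on monic homogeneous polynomials: if $\Gamma$ is represented by $\begin{bmatrix}a&b\\c&d\end{bmatrix}$, then $\Gamma(f)$ is the unique monic scalar multiple of $f(dx-by,-cx+ay)$. The homogenized minimal polynomial of $\alpha$ of degree $m$ with minimal polynomial $h(x)$ is $y^mh(x/y)$. A complete set of unique representatives means a set containing exactly one element of each orbit. -}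

module Defs where

open import Level using (0ℓ)
open import Data.Nat as ℕ using (ℕ; zero; suc; _∸_; _≤_; _%_; _/_)
open import Data.List using (List; []; _∷_; _++_; [_]; length; map; foldr; zipWith; upTo; replicate)
open import Data.List.Membership.Propositional using (_∈_)
open import Data.List.Relation.Unary.All using (All)
open import Data.List.Relation.Unary.Unique.Propositional using (Unique)
open import Data.Product using (Σ; ∃; ∃-syntax; _×_; _,_)
open import Relation.Binary.PropositionalEquality using (_≡_; _≢_)
open import Relation.Binary.Definitions using (DecidableEquality)
open import Algebra.Structures using (IsCommutativeRing)

record FiniteField : Set₁ where
  infixl 7 _*_
  infixl 6 _+_ _-_
  field
    Carrier  : Set
    _+_ _*_  : Carrier → Carrier → Carrier
    -_       : Carrier → Carrier
    0# 1#    : Carrier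
    isCommutativeRing : IsCommutativeRing _≡_ _+_ _*_ -_ 0# 1#
    0≢1      : 0# ≢ 1#
    -- total inverse (convention 0⁻¹ = 0); x * x⁻¹ = 1 for x ≠ 0
    _⁻¹      : Carrier → Carrier
    ⁻¹-inverse : ∀ x → x ≢ 0# → x * (x ⁻¹) ≡ 1#
    _≟_      : DecidableEquality Carrier
    elements : List Carrier
    complete : ∀ x → x ∈ elements
    unique   : Unique elements

  _-_ : Carrier → Carrier → Carrier
  x - y = x + (- y)

  size : ℕ
  size = length elements

  _^_ : Carrier → ℕ → Carrier
  x ^ zero  = 1#
  x ^ suc n = x * (x ^ n)

El : FiniteField → Set
El = FiniteField.Carrier

card : FiniteField → ℕ
card = FiniteField.size

-- a field embedding K ↪ L (ring homomorphism of fields; injective automatically)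
record Embedding (K L : FiniteField) : Set where
  private
    module K = FiniteField K
    module L = FiniteField L
  field
    emb     : K.Carrier → L.Carrier
    emb-+   : ∀ x y → emb (x K.+ y) ≡ emb x L.+ emb y
    emb-*   : ∀ x y → emb (x K.* y) ≡ emb x L.* emb y
    emb-1   : emb K.1# ≡ L.1#

Generator : (L : FiniteField) → El L → Set
Generator L ζ = ∀ x → x ≢ 0# → ∃[ i ] ζ ^ i ≡ x
  where open FiniteField L

-- Polynomials and binary forms over a field K.
-- A univariate polynomial is a coefficient list [a₀,…,aₙ] (Σ aᵢ xⁱ).
-- A binary form of degree n is a coefficient list [a₀,…,aₙ] of length n+1,
-- standing for Σ aᵢ xⁱ yⁿ⁻ⁱ.  (So f(x,1) = Σ aᵢ xⁱ.)

module Poly (K : FiniteField) where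
  open FiniteField K

  addP : List Carrier → List Carrier → List Carrier
  addP []       q        = q
  addP (a ∷ p)  []       = a ∷ p
  addP (a ∷ p)  (b ∷ q)  = (a + b) ∷ addP p q

  scale : Carrier → List Carrier → List Carrier
  scale c = map (c *_)

  mulP : List Carrier → List Carrier → List Carrier
  mulP []      q = []
  mulP (a ∷ p) q = addP (scale a q) (0# ∷ mulP p q)

  powP : List Carrier → ℕ → List Carrier
  powP p zero    = [ 1# ]
  powP p (suc n) = mulP p (powP p n)

  substForm : (a b c d : Carrier) → List Carrier → List Carrier
  substForm a b c d f =
    foldr addP (replicate (length f) 0#)
      (zipWith (λ i aᵢ → scale aᵢ (mulP (powP (- b ∷ d ∷ []) i)
                                        (powP (a ∷ - c ∷ []) (n ∸ i))))
               (upTo (length f)) f)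
    where n = length f ∸ 1

  -- f monic: f(x,1) = Σ aᵢ xⁱ is monic, i.e. its last nonzero coefficient is 1
  MonicForm : List Carrier → Set
  MonicForm f = Σ (List Carrier) λ p → Σ (List Carrier) λ zs →
                  All (_≡ 0#) zs × f ≡ p ++ (1# ∷ zs)

  -- action of the class of [[a,b],[c,d]] ∈ PGL₂(K):  Γ(f) = f'  iff
  -- f' is the (unique) monic scalar multiple of f(dx − by, −cx + ay)
  Acts : (a b c d : Carrier) → List Carrier → List Carrier → Set
  Acts a b c d f f' =
    MonicForm f' × ∃[ λ′ ] (λ′ ≢ 0# × f' ≡ scale λ′ (substForm a b c d f))

  SameOrbit : List Carrier → List Carrier → Set
  SameOrbit f f' = ∃[ a ] ∃[ b ] ∃[ c ] ∃[ d ]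
                     ((a * d - b * c) ≢ 0# × Acts a b c d f f')

  Linear : List Carrier → Set
  Linear l = length l ≡ 2

  Quadratic : List Carrier → Set
  Quadratic g = length g ≡ 3

  IrreducibleQuadratic : List Carrier → Set
  IrreducibleQuadratic g = Quadratic g ×
    (∀ l₁ l₂ → Linear l₁ → Linear l₂ → g ≢ mulP l₁ l₂)

  TwoQuadQuartic : List Carrier → Set
  TwoQuadQuartic f = length f ≡ 5 × ∃[ g₁ ] ∃[ g₂ ]
    (MonicForm g₁ × IrreducibleQuadratic g₁ ×
     MonicForm g₂ × IrreducibleQuadratic g₂ ×
     g₁ ≢ g₂ × f ≡ mulP g₁ g₂)

  CompleteReps : (P R : List Carrier → Set) → Set
  CompleteReps P R =
    (∀ r → R r → P r) ×
    (∀ f → P f → ∃[ r ] (R r × SameOrbit f r)) ×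
    (∀ r r' → R r → R r' → SameOrbit r r' → r ≡ r')

module MinPoly {K L : FiniteField} (ι : Embedding K L) where
  private
    module K = FiniteField K
    module L = FiniteField L
  open Embedding ι renaming (emb to ιm)

  eval : List K.Carrier → L.Carrier → L.Carrier
  eval []      α = L.0#
  eval (a ∷ h) α = ιm a L.+ α L.* eval h α

  MonicPoly : List K.Carrier → Set
  MonicPoly h = ∃[ p ] h ≡ p ++ [ K.1# ]

  NonzeroPoly : List K.Carrier → Set
  NonzeroPoly h = ∃[ p ] ∃[ c ] (c ≢ K.0# × h ≡ p ++ [ c ])

  IsMinPoly : L.Carrier → List K.Carrier → Set
  IsMinPoly α h = MonicPoly h × eval h α ≡ L.0# ×
    (∀ h' → NonzeroPoly h' → eval h' α ≡ L.0# → length h ≤ length h')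

  -- homogenization yᵐ h(x/y), m = deg h: with the coefficient-list convention
  -- for forms (aᵢ is the coefficient of xⁱ yᵐ⁻ⁱ) it has the same coefficients
  homogenize : List K.Carrier → List K.Carrier
  homogenize h = h

module Setup {K L : FiniteField} (ι : Embedding K L) (ζ ρ : El L) where
  private
    module K = FiniteField K
    module L = FiniteField L
  open MinPoly ι

  s : ℕ → L.Carrier
  s i = ρ L.* ((ζ L.^ i) L.- L.1#) L.* (((ζ L.^ i) L.+ L.1#) L.⁻¹)

  InT22 : List K.Carrier → Set
  InT22 g = ∃[ i ] (1 ≤ i × i ≤ (card K ∸ 1) / 2 ×
              ∃[ h ] (IsMinPoly (s i) h × g ≡ homogenize h))

{-# OPTIONS --safe #-}

-- Counting gives L = K ⊕ Kρ, so every monic irreducible quadratic over K is the minimal polynomial of some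
-- x + yρ with y ≠ 0, and γ = N(ζ) generates the cyclic group K^× (an element of norm 1 is v/v̄ by Hilbert 90,
-- so if γ had order m there would be at most m(q+1) elements in L^×).
--
-- Existence: an affine map moves a root of the first factor to ρ. In the coordinate w = (ρ+s)/(ρ−s) the
-- stabilizer of ρ acts by multiplication by the elements v/v̄ of norm 1, so the second root s matters only
-- through N(w) = γᵏ, and conjugating s replaces γᵏ by γ⁻ᵏ. Hence 0 < i ≤ (q−1)/2 suffices.
--
-- Uniqueness: for two quadratic forms with polarized discriminant B, the ratio B(g,h)²/(B(g,g)B(h,h)) is
-- PGL₂-invariant and symmetric. For g = x²−νy² and the minimal polynomial h of s it equals
-- ((N(w)+1)/(N(w)−1))², which determines N(w) up to inversion.

module Submission where

open import Defs
open import Level using (0ℓ)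
open import Algebra.Bundles using (CommutativeRing)
import Algebra.Properties.Ring as RingProperties
import Algebra.Properties.Semiring.Mult.TCOptimised as Mult
import Algebra.Solver.Ring as RingSolver
open import Algebra.Solver.Ring.AlmostCommutativeRing using (fromCommutativeRing; _-Raw-AlmostCommutative⟶_)
open import Data.Empty using (⊥-elim)
open import Data.Fin as Fin using (Fin; toℕ; #_)
import Data.Fin.Properties as Finₚ
open import Data.Integer as ℤ using (ℤ)
import Data.Integer.Properties as ℤₚ
open import Data.List using (List; []; _∷_; [_]; _++_; length; lookup; map; foldr; zipWith; replicate; applyUpTo; upTo; cartesianProductWith)
open import Data.List.Properties using (length-map; length-applyUpTo; length-++)
open import Data.List.Membership.Propositional using (_∈_)
open import Data.List.Membership.Propositional.Properties using (∈-lookup; ∈-map⁺; ∈-map⁻; ∈-upTo⁺; ∈-cartesianProductWith⁺; ∈-cartesianProductWith⁻; ∈-applyUpTo⁻)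
import Data.List.Membership.DecPropositional as DecMembership
open import Data.List.Relation.Binary.Subset.Propositional using (_⊆_)
open import Data.List.Relation.Unary.All as All using ([]; _∷_)
import Data.List.Relation.Unary.All.Properties as Allₚ
open import Data.List.Relation.Unary.AllPairs using ([]; _∷_)
open import Data.List.Relation.Unary.Any as Any using (here; there)
open import Data.List.Relation.Unary.Any.Properties using (lookup-index)
open import Data.List.Relation.Unary.Unique.Propositional using (Unique)
import Data.List.Relation.Unary.Unique.Propositional.Properties as Unique
import Data.Maybe as Maybe
open import Data.Nat as ℕ using (ℕ; zero; suc; _∸_)
import Data.Nat.DivMod as ℕ÷
import Data.Nat.Properties as ℕₚ
open import Data.Product using (∃-syntax; _×_; _,_; proj₁; proj₂)
open import Data.Sum using (_⊎_; inj₁; inj₂; [_,_]′)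
open import Data.Vec using ([]; _∷_)
open import Function using (_∘_)
open import Relation.Binary.Definitions using (Tri; tri<; tri≈; tri>)
open import Relation.Binary.PropositionalEquality using (_≡_; _≢_; refl; sym; trans; cong; cong₂; subst; subst₂; module ≡-Reasoning)
open import Relation.Nullary using (¬_; Dec; yes; no)
open import Relation.Nullary.Decidable using (dec⇒maybe; toSum)

-- The coordinate w = (ρ+s)/(ρ-s) sends ρ to ∞ and its conjugate -ρ to 0. Multiplication by v = a+bρ
-- has the matrix [[a, bν], [b, a]], which fixes both ρ and -ρ, so it can only scale w, and the
-- factor is v/v̄. Conjugating s turns w into 1/w̄, whence the inversion of N(w). The projective
-- line over K becomes the circle N(w) = 1, so a root of an irreducible second factor other than
-- x²-νy² has N(w) different from 0 and 1. The exponents 0 < k < q-1 are paired by k ↦ q-1-k; the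
-- fixed point (q-1)/2 of this pairing is why the upper bound is attained.
--
-- The stabilizer of ρ cannot settle uniqueness by itself, because a group element may also send
-- x²-νy² to a multiple of the other factor. A ratio symmetric in the two factors makes this
-- distinction harmless, and the only fact about factorizations behind it is that ρ is a root of one
-- of the factors.
--
-- Conjugation is y ↦ -y on coordinates and the norm is the form x²-νy². The facts about finite
-- fields, such as γ^(q-1) = 1, come from comparing lengths of duplicate-free lists.

lookup-injective : {A : Set} {xs : List A} → Unique xs →
                   ∀ {i j} → lookup xs i ≡ lookup xs j → i ≡ j
lookup-injective (_ ∷ _)   {Fin.zero}  {Fin.zero}  _  = refl
lookup-injective {xs = _ ∷ xs} (x∉ ∷ _) {Fin.zero}  {Fin.suc j} eq = ⊥-elim (All.lookup x∉ (∈-lookup {xs = xs} j) eq)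
lookup-injective {xs = _ ∷ xs} (x∉ ∷ _) {Fin.suc i} {Fin.zero}  eq = ⊥-elim (All.lookup x∉ (∈-lookup {xs = xs} i) (sym eq))
lookup-injective (_ ∷ u)   {Fin.suc i} {Fin.suc j} eq = cong Fin.suc (lookup-injective u eq)

unique-⊆⇒length≤ : {A : Set} {xs ys : List A} → Unique xs → xs ⊆ ys → length xs ℕ.≤ length ys
unique-⊆⇒length≤ {xs = xs} {ys} u sub = Finₚ.injective⇒≤ {f = position} (λ {i} {j} eq → lookup-injective u (begin
    lookup xs i             ≡⟨ lookup-index (sub (∈-lookup i)) ⟩
    lookup ys (position i)  ≡⟨ cong (lookup ys) eq ⟩
    lookup ys (position j)  ≡⟨ lookup-index (sub (∈-lookup j)) ⟨
    lookup xs j             ∎))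
  where
  open ≡-Reasoning
  position : Fin (length xs) → Fin (length ys)
  position i = Any.index (sub (∈-lookup i))

-- Coefficients are taken in ℤ rather than in F, where equality does not compute, so that solver goals close by refl.
module IntegerRingSolver (F : FiniteField) where
  open FiniteField F hiding (_^_)

  commutativeRing : CommutativeRing 0ℓ 0ℓ
  commutativeRing = record { isCommutativeRing = isCommutativeRing }

  open CommutativeRing commutativeRing using (ring; semiring)
  private
    module M = Mult semiring
    module R = CommutativeRing commutativeRing
    module RP = RingProperties ring

    fromℤ : ℤ → Carrier
    fromℤ (ℤ.+ n)      = n M.× 1#
    fromℤ ℤ.-[1+ n ]   = - (suc n M.× 1#)

    fromℤ-neg : ∀ i → fromℤ (ℤ.- i) ≡ - fromℤ i
    fromℤ-neg (ℤ.+ zero)  = sym RP.-0#≈0#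
    fromℤ-neg (ℤ.+ suc n) = refl
    fromℤ-neg ℤ.-[1+ n ]  = sym (RP.-‿involutive _)

    fromℤ-⊖ : ∀ m n → fromℤ (m ℤ.⊖ n) ≡ m M.× 1# + - (n M.× 1#)
    fromℤ-⊖ m zero = sym (trans (cong (m M.× 1# +_) RP.-0#≈0#) (R.+-identityʳ _))
    fromℤ-⊖ zero (suc n) = sym (R.+-identityˡ _)
    fromℤ-⊖ (suc m) (suc n) = begin
        fromℤ (suc m ℤ.⊖ suc n)                ≡⟨ cong fromℤ (ℤₚ.[1+m]⊖[1+n]≡m⊖n m n) ⟩
        fromℤ (m ℤ.⊖ n)                        ≡⟨ fromℤ-⊖ m n ⟩
        a + - b                                ≡⟨ cong (_+ - b) (sym (R.+-identityʳ a)) ⟩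
        a + 0# + - b                           ≡⟨ cong (λ t → a + t + - b) (sym (R.-‿inverseʳ 1#)) ⟩
        a + (1# + - 1#) + - b                  ≡⟨ cong (_+ - b) (sym (R.+-assoc a 1# (- 1#))) ⟩
        a + 1# + - 1# + - b                    ≡⟨ R.+-assoc _ _ _ ⟩
        a + 1# + (- 1# + - b)                  ≡⟨ cong₂ _+_ (trans (R.+-comm a 1#) (sym (M.1+× m 1#)))
                                                    (trans (RP.-‿+-comm 1# b) (cong -_ (sym (M.1+× n 1#)))) ⟩
        suc m M.× 1# + - (suc n M.× 1#)        ∎
      where
      open ≡-Reasoning
      a = m M.× 1#
      b = n M.× 1#

    fromℤ-+ : ∀ i j → fromℤ (i ℤ.+ j) ≡ fromℤ i + fromℤ j
    fromℤ-+ (ℤ.+ m)    (ℤ.+ n)    = M.×-homo-+ 1# m n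
    fromℤ-+ (ℤ.+ m)    ℤ.-[1+ n ] = fromℤ-⊖ m (suc n)
    fromℤ-+ ℤ.-[1+ m ] (ℤ.+ n)    = trans (fromℤ-⊖ n (suc m)) (R.+-comm _ _)
    fromℤ-+ ℤ.-[1+ m ] ℤ.-[1+ n ] = begin
        - (suc (suc (m ℕ.+ n)) M.× 1#)          ≡⟨ cong (λ t → - (suc t M.× 1#)) (ℕₚ.+-suc m n) ⟨
        - ((suc m ℕ.+ suc n) M.× 1#)            ≡⟨ cong -_ (M.×-homo-+ 1# (suc m) (suc n)) ⟩
        - (suc m M.× 1# + suc n M.× 1#)         ≡⟨ RP.-‿+-comm _ _ ⟨
        - (suc m M.× 1#) + - (suc n M.× 1#)     ∎
      where open ≡-Reasoning

    fromℤ-+* : ∀ m j → fromℤ (ℤ.+ m ℤ.* j) ≡ m M.× 1# * fromℤ j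
    fromℤ-+* m (ℤ.+ n) = trans (cong fromℤ (sym (ℤₚ.pos-* m n))) (M.×1-homo-* m n)
    fromℤ-+* m ℤ.-[1+ n ] = begin
        fromℤ (ℤ.+ m ℤ.* ℤ.- (ℤ.+ suc n))       ≡⟨ cong fromℤ (ℤₚ.neg-distribʳ-* (ℤ.+ m) (ℤ.+ suc n)) ⟨
        fromℤ (ℤ.- (ℤ.+ m ℤ.* ℤ.+ suc n))       ≡⟨ fromℤ-neg (ℤ.+ m ℤ.* ℤ.+ suc n) ⟩
        - fromℤ (ℤ.+ m ℤ.* ℤ.+ suc n)           ≡⟨ cong (-_ ∘ fromℤ) (ℤₚ.pos-* m (suc n)) ⟨
        - ((m ℕ.* suc n) M.× 1#)                ≡⟨ cong -_ (M.×1-homo-* m (suc n)) ⟩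
        - (m M.× 1# * suc n M.× 1#)             ≡⟨ RP.-‿distribʳ-* _ _ ⟩
        m M.× 1# * - (suc n M.× 1#)             ∎
      where open ≡-Reasoning

    fromℤ-* : ∀ i j → fromℤ (i ℤ.* j) ≡ fromℤ i * fromℤ j
    fromℤ-* (ℤ.+ m)    j = fromℤ-+* m j
    fromℤ-* ℤ.-[1+ m ] j = begin
        fromℤ (ℤ.- (ℤ.+ suc m) ℤ.* j)           ≡⟨ cong fromℤ (ℤₚ.neg-distribˡ-* (ℤ.+ suc m) j) ⟨
        fromℤ (ℤ.- (ℤ.+ suc m ℤ.* j))           ≡⟨ fromℤ-neg (ℤ.+ suc m ℤ.* j) ⟩
        - fromℤ (ℤ.+ suc m ℤ.* j)               ≡⟨ cong -_ (fromℤ-+* (suc m) j) ⟩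
        - (suc m M.× 1# * fromℤ j)              ≡⟨ RP.-‿distribˡ-* _ _ ⟩
        - (suc m M.× 1#) * fromℤ j              ∎
      where open ≡-Reasoning

    fromℤ-homomorphism : ℤ.+-*-rawRing -Raw-AlmostCommutative⟶ fromCommutativeRing commutativeRing
    fromℤ-homomorphism = record
      { ⟦_⟧ = fromℤ ; +-homo = fromℤ-+ ; *-homo = fromℤ-* ; -‿homo = fromℤ-neg ; 0-homo = refl ; 1-homo = refl }

  open RingSolver ℤ.+-*-rawRing (fromCommutativeRing commutativeRing) fromℤ-homomorphism
    (λ i j → Maybe.map (cong fromℤ) (dec⇒maybe (i ℤ.≟ j))) public

-- Arithmetic for counting and halving

length-cartesianProductWith : {A B C : Set} (f : A → B → C) (xs : List A) (ys : List B) →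
  length (cartesianProductWith f xs ys) ≡ length xs ℕ.* length ys
length-cartesianProductWith f []       ys = refl
length-cartesianProductWith f (x ∷ xs) ys = trans (length-++ (map (f x) ys))
  (cong₂ ℕ._+_ (length-map (f x) ys) (length-cartesianProductWith f xs ys))

parity : ∀ n → ∃[ h ] (n ≡ h ℕ.+ h ⊎ n ≡ suc (h ℕ.+ h))
parity zero    = 0 , inj₁ refl
parity (suc n) with parity n
... | h , inj₁ n≡2h   = h , inj₂ (cong suc n≡2h)
... | h , inj₂ n≡1+2h = suc h , inj₁ (cong suc (trans n≡1+2h (sym (ℕₚ.+-suc h h))))

-- The estimate behind the order of γ: zero together with m+1 powers of ζ times q+1 elements of norm
-- 1 cannot fill a field of q² elements unless m+1 ≥ q-1.
1+[1+m][1+q]<q² : ∀ {m q} → suc (suc m) ℕ.< q → suc (suc m ℕ.* suc q) ℕ.< q ℕ.* q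
1+[1+m][1+q]<q² {m} {q} 2+m<q = begin-strict
    suc (suc m ℕ.* suc q)          ≡⟨ cong suc (ℕₚ.*-suc (suc m) q) ⟩
    suc (suc m) ℕ.+ suc m ℕ.* q    <⟨ ℕₚ.+-monoˡ-< (suc m ℕ.* q) 2+m<q ⟩
    suc (suc m) ℕ.* q              ≤⟨ ℕₚ.*-monoˡ-≤ q (ℕₚ.<⇒≤ 2+m<q) ⟩
    q ℕ.* q                        ∎
  where open ℕₚ.≤-Reasoning

n/2+n/2≤n : ∀ n → n ℕ./ 2 ℕ.+ n ℕ./ 2 ℕ.≤ n
n/2+n/2≤n n = ℕₚ.≤-trans (ℕₚ.≤-reflexive (trans (cong (n ℕ./ 2 ℕ.+_) (sym (ℕₚ.+-identityʳ _))) (ℕₚ.*-comm 2 (n ℕ./ 2))))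
  (ℕ÷.m/n*n≤m n 2)

n≤1+n/2+n/2 : ∀ n → n ℕ.≤ suc (n ℕ./ 2 ℕ.+ n ℕ./ 2)
n≤1+n/2+n/2 n = begin
    n                                ≡⟨ ℕ÷.m≡m%n+[m/n]*n n 2 ⟩
    n ℕ.% 2 ℕ.+ n ℕ./ 2 ℕ.* 2        ≤⟨ ℕₚ.+-monoˡ-≤ _ (ℕ.s≤s⁻¹ (ℕ÷.m%n<n n 2)) ⟩
    suc (n ℕ./ 2 ℕ.* 2)              ≡⟨ cong suc (ℕₚ.*-comm (n ℕ./ 2) 2) ⟩
    suc (n ℕ./ 2 ℕ.+ (n ℕ./ 2 ℕ.+ 0)) ≡⟨ cong (λ t → suc (n ℕ./ 2 ℕ.+ t)) (ℕₚ.+-identityʳ _) ⟩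
    suc (n ℕ./ 2 ℕ.+ n ℕ./ 2)        ∎
  where open ℕₚ.≤-Reasoning

-- Field identities from certificates

module FieldLemmas (F : FiniteField) where
  open FiniteField F
  open IntegerRingSolver F
  open CommutativeRing commutativeRing
    using (*-assoc; +-assoc; distribˡ; *-comm; zeroˡ; zeroʳ; *-identityˡ; *-identityʳ; +-identityˡ; +-identityʳ; -‿inverseʳ) public

  two : Carrier
  two = 1# + 1#

  x-y≡0⇒x≡y : ∀ {x y} → x - y ≡ 0# → x ≡ y
  x-y≡0⇒x≡y {x} {y} eq = begin
    x            ≡⟨ solve 2 (λ x y → x := (x :- y) :+ y) refl x y ⟩
    (x - y) + y  ≡⟨ cong (_+ y) eq ⟩
    0# + y       ≡⟨ +-identityˡ y ⟩
    y            ∎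
    where open ≡-Reasoning

  multiple-of-zero : ∀ c {l r} → l ≡ r → c * (l - r) ≡ 0#
  multiple-of-zero c {l} refl = trans (cong (c *_) (-‿inverseʳ l)) (zeroʳ c)

  -- Certificate format for consequences of hypotheses: x-y is written as an explicit combination of
  -- the differences l-r, and what remains is a polynomial identity for the solver.
  linear-combination₁ : ∀ {x y} c {l r} → l ≡ r → x - y ≡ c * (l - r) → x ≡ y
  linear-combination₁ c eq id = x-y≡0⇒x≡y (trans id (multiple-of-zero c eq))

  linear-combination₂ : ∀ {x y} c {l r} → l ≡ r → ∀ c′ {l′ r′} → l′ ≡ r′ →
                        x - y ≡ c * (l - r) + c′ * (l′ - r′) → x ≡ y
  linear-combination₂ c eq c′ eq′ id = x-y≡0⇒x≡y
    (trans id (trans (cong₂ _+_ (multiple-of-zero c eq) (multiple-of-zero c′ eq′)) (+-identityʳ 0#)))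

  linear-combination₃ : ∀ {x y} c {l r} → l ≡ r → ∀ c′ {l′ r′} → l′ ≡ r′ → ∀ c″ {l″ r″} → l″ ≡ r″ →
                        x - y ≡ c * (l - r) + c′ * (l′ - r′) + c″ * (l″ - r″) → x ≡ y
  linear-combination₃ c eq c′ eq′ c″ eq″ id = linear-combination₂ c eq c′ eq′
    (trans id (trans (cong₂ _+_ refl (multiple-of-zero c″ eq″)) (+-identityʳ _)))

  *-cancelˡ : ∀ {c x y} → c ≢ 0# → c * x ≡ c * y → x ≡ y
  *-cancelˡ {c} {x} {y} c≢0 eq = begin
      x               ≡⟨ expand x ⟩
      c ⁻¹ * (c * x)  ≡⟨ cong (c ⁻¹ *_) eq ⟩
      c ⁻¹ * (c * y)  ≡⟨ expand y ⟨
      y               ∎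
    where
    open ≡-Reasoning
    expand : ∀ t → t ≡ c ⁻¹ * (c * t)
    expand t = linear-combination₁ (- t) (⁻¹-inverse c c≢0)
      (solve 3 (λ t c d → t :- d :* (c :* t) := (:- t) :* (c :* d :- con (ℤ.+ 1))) refl t c (c ⁻¹))

  zero-product : ∀ {x y} → x * y ≡ 0# → x ≡ 0# ⊎ y ≡ 0#
  zero-product {x} {y} eq with x ≟ 0#
  ... | yes x≡0 = inj₁ x≡0
  ... | no  x≢0 = inj₂ (*-cancelˡ x≢0 (trans eq (sym (zeroʳ x))))

  *-nonzero : ∀ {x y} → x ≢ 0# → y ≢ 0# → x * y ≢ 0#
  *-nonzero x≢0 y≢0 = [ x≢0 , y≢0 ]′ ∘ zero-product

  ^-nonzero : ∀ {x} n → x ≢ 0# → x ^ n ≢ 0#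
  ^-nonzero zero    x≢0 eq = 0≢1 (sym eq)
  ^-nonzero (suc n) x≢0    = *-nonzero x≢0 (^-nonzero n x≢0)

  ^-+ : ∀ x m n → x ^ (m ℕ.+ n) ≡ x ^ m * x ^ n
  ^-+ x zero    n = sym (*-identityˡ _)
  ^-+ x (suc m) n = trans (cong (x *_) (^-+ x m n)) (sym (*-assoc x _ _))

  1^n≡1 : ∀ n → 1# ^ n ≡ 1#
  1^n≡1 zero    = refl
  1^n≡1 (suc n) = trans (*-identityˡ _) (1^n≡1 n)

  ^-* : ∀ x m n → x ^ (m ℕ.* n) ≡ (x ^ n) ^ m
  ^-* x zero    n = refl
  ^-* x (suc m) n = trans (^-+ x n (m ℕ.* n)) (cong (x ^ n *_) (^-* x m n))

  -- A missing element could be prepended, giving a duplicate-free list longer than `elements`. This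
  -- is how injectivity turns into surjectivity throughout.
  unique-size⇒complete : ∀ {xs} → Unique xs → length xs ≡ size → ∀ x → x ∈ xs
  unique-size⇒complete {xs} u len x with DecMembership._∈?_ _≟_ x xs
  ... | yes x∈xs = x∈xs
  ... | no  x∉xs = ⊥-elim (ℕₚ.<⇒≱ (ℕₚ.≤-reflexive (cong suc (sym len)))
                     (unique-⊆⇒length≤ (Allₚ.¬Any⇒All¬ xs x∉xs ∷ u) (λ {y} _ → complete y)))

  +-collect : ∀ x y x′ y′ r → (x + y * r) + (x′ + y′ * r) ≡ (x + x′) + (y + y′) * r
  +-collect = solve 5 (λ x y x′ y′ r → (x :+ y :* r) :+ (x′ :+ y′ :* r) := (x :+ x′) :+ (y :+ y′) :* r) refl

  neg-collect : ∀ x y r → - (x + y * r) ≡ - x + - y * r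
  neg-collect = solve 3 (λ x y r → :- (x :+ y :* r) := :- x :+ :- y :* r) refl

  *-collect : ∀ x y x′ y′ r → (x + y * r) * (x′ + y′ * r) ≡ (x * x′ + r * r * (y * y′)) + (x * y′ + y * x′) * r
  *-collect = solve 5 (λ x y x′ y′ r → (x :+ y :* r) :* (x′ :+ y′ :* r) :=
    (x :* x′ :+ r :* r :* (y :* y′)) :+ (x :* y′ :+ y :* x′) :* r) refl

  linear-root : ∀ {x y y⁻¹ r} → x + y * r ≡ 0# → y * y⁻¹ ≡ 1# → - (x * y⁻¹) ≡ r
  linear-root {x} {y} {d} {r} eq inv = linear-combination₂ (- d) eq r inv
    (solve 4 (λ x y d r → :- (x :* d) :- r := (:- d) :* (x :+ y :* r :- con (ℤ.+ 0)) :+ r :* (y :* d :- con (ℤ.+ 1))) refl x y d r)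

  divide : ∀ {x y z} → x * y ≡ z → y ≢ 0# → x ≡ z * y ⁻¹
  divide {x} {y} {z} eq y≢0 = linear-combination₂ (y ⁻¹) eq (- x) (⁻¹-inverse y y≢0)
    (solve 4 (λ x y z d → x :- z :* d := d :* (x :* y :- z) :+ (:- x) :* (y :* d :- con (ℤ.+ 1))) refl x y z (y ⁻¹))

  */-cancel : ∀ {x y} → y ≢ 0# → x * y ⁻¹ * y ≡ x
  */-cancel {x} {y} y≢0 = linear-combination₁ x (⁻¹-inverse y y≢0)
    (solve 3 (λ x y d → x :* d :* y :- x := x :* (y :* d :- con (ℤ.+ 1))) refl x y (y ⁻¹))

  neg-product : ∀ x y r → x - y * r ≡ x + - y * r
  neg-product = solve 3 (λ x y r → x :- y :* r := x :+ :- y :* r) refl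

  ⁻¹-nonzero : ∀ {x} → x ≢ 0# → x ⁻¹ ≢ 0#
  ⁻¹-nonzero {x} x≢0 eq = 0≢1 (trans (sym (zeroʳ x)) (trans (cong (x *_) (sym eq)) (⁻¹-inverse x x≢0)))

  neg≡0 : ∀ {x} → - x ≡ 0# → x ≡ 0#
  neg≡0 {x} eq = linear-combination₁ (- 1#) eq
    (solve 1 (λ x → x :- con (ℤ.+ 0) := (:- con (ℤ.+ 1)) :* (:- x :- con (ℤ.+ 0))) refl x)

  -- With s = ρ(w−1)/(w+1) one has w = (ρ+s)/(ρ−s), so the first hypothesis says that multiplication by
  -- (a+bρ)/(a−bρ) in this coordinate moves β to s; it is the Möbius map x ↦ (ax+bρ²)/(bx+a).
  möbius-coordinate : ∀ {w ρ β s a b} → w * (ρ - β) * (a - b * ρ) ≡ (ρ + β) * (a + b * ρ) →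
    s * (w + 1#) ≡ ρ * (w - 1#) → w + 1# ≢ 0# → a * β + b * (ρ * ρ) ≡ s * (b * β + a)
  möbius-coordinate {w} {ρ} {β} {s} {a} {b} eq s-eq w≢-1 = *-cancelˡ w≢-1
    (linear-combination₂ (- 1#) eq (- (b * β + a)) s-eq
      (solve 6 (λ w ρ β s a b → let one = con (ℤ.+ 1) in
        (w :+ one) :* (a :* β :+ b :* (ρ :* ρ)) :- (w :+ one) :* (s :* (b :* β :+ a)) :=
        (:- one) :* (w :* (ρ :- β) :* (a :- b :* ρ) :- (ρ :+ β) :* (a :+ b :* ρ)) :+
        (:- (b :* β :+ a)) :* (s :* (w :+ one) :- ρ :* (w :- one))) refl w ρ β s a b))

-- The operations of Poly on lists of solver expressions: evaluating their results gives, definitionally, the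
-- coefficients computed by Poly, so coefficient identities are proved without being written out.
module SymbolicForms (K : FiniteField) (n : ℕ) where
  open IntegerRingSolver K

  Coeffs : Set
  Coeffs = List (Polynomial n)

  addP : Coeffs → Coeffs → Coeffs
  addP []      q       = q
  addP (a ∷ p) []      = a ∷ p
  addP (a ∷ p) (b ∷ q) = (a :+ b) ∷ addP p q

  scale : Polynomial n → Coeffs → Coeffs
  scale c = map (c :*_)

  mulP : Coeffs → Coeffs → Coeffs
  mulP []      q = []
  mulP (a ∷ p) q = addP (scale a q) (con (ℤ.+ 0) ∷ mulP p q)

  powP : Coeffs → ℕ → Coeffs
  powP p zero    = con (ℤ.+ 1) ∷ []
  powP p (suc k) = mulP p (powP p k)

  substForm : (a b c d : Polynomial n) → Coeffs → Coeffs
  substForm a b c d f =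
    foldr addP (replicate (length f) (con (ℤ.+ 0)))
      (zipWith (λ i aᵢ → scale aᵢ (mulP (powP (:- b ∷ d ∷ []) i) (powP (a ∷ :- c ∷ []) (length f ∸ 1 ∸ i))))
               (upTo (length f)) f)

  coeff : ℕ → Coeffs → Polynomial n
  coeff _       []      = con (ℤ.+ 0)
  coeff zero    (a ∷ _) = a
  coeff (suc k) (_ ∷ p) = coeff k p

-- Binary quadratic forms and the polarized discriminant

module BinaryForms (K : FiniteField) where
  open FiniteField K
  open Poly K
  open IntegerRingSolver K
  open FieldLemmas K

  list-cong₃ : ∀ {a a' b b' c c' : Carrier} → a ≡ a' → b ≡ b' → c ≡ c' → _≡_ {A = List Carrier} (a ∷ b ∷ c ∷ []) (a' ∷ b' ∷ c' ∷ [])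
  list-cong₃ refl refl refl = refl

  list-cong₅ : ∀ {a a' b b' c c' d d' e e' : Carrier} → a ≡ a' → b ≡ b' → c ≡ c' → d ≡ d' → e ≡ e' →
     _≡_ {A = List Carrier} (a ∷ b ∷ c ∷ d ∷ e ∷ []) (a' ∷ b' ∷ c' ∷ d' ∷ e' ∷ [])
  list-cong₅ refl refl refl refl refl = refl

  substQuad : (a b c d u₀ u₁ u₂ : Carrier) →
    substForm a b c d (u₀ ∷ u₁ ∷ u₂ ∷ []) ≡
      (u₀ * (a * a) - u₁ * (a * b) + u₂ * (b * b)) ∷
      (u₁ * (a * d + b * c) - two * (u₀ * (a * c)) - two * (u₂ * (b * d))) ∷
      (u₀ * (c * c) - u₁ * (c * d) + u₂ * (d * d)) ∷ []
  substQuad a b c d u₀ u₁ u₂ = list-cong₃ (by 0 (U₀ :* (A :* A) :- U₁ :* (A :* B) :+ U₂ :* (B :* B)) refl)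
      (by 1 (U₁ :* (A :* D :+ B :* C) :- (con (ℤ.+ 2)) :* (U₀ :* (A :* C)) :- (con (ℤ.+ 2)) :* (U₂ :* (B :* D))) refl)
      (by 2 (U₀ :* (C :* C) :- U₁ :* (C :* D) :+ U₂ :* (D :* D)) refl)
    where
    module S = SymbolicForms K 7
    A = var (# 0) ; B = var (# 1) ; C = var (# 2) ; D = var (# 3)
    U₀ = var (# 4) ; U₁ = var (# 5) ; U₂ = var (# 6)
    env = a ∷ b ∷ c ∷ d ∷ u₀ ∷ u₁ ∷ u₂ ∷ []
    by : ∀ k e → let l = S.coeff k (S.substForm A B C D (U₀ ∷ U₁ ∷ U₂ ∷ [])) in
         ⟦ l ⟧↓ env ≡ ⟦ e ⟧↓ env → ⟦ l ⟧ env ≡ ⟦ e ⟧ env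
    by k e = prove env (S.coeff k (S.substForm A B C D (U₀ ∷ U₁ ∷ U₂ ∷ []))) e

  substForm-mulP : (a b c d u₀ u₁ u₂ v₀ v₁ v₂ : Carrier) →
    substForm a b c d (mulP (u₀ ∷ u₁ ∷ u₂ ∷ []) (v₀ ∷ v₁ ∷ v₂ ∷ [])) ≡
    mulP (substForm a b c d (u₀ ∷ u₁ ∷ u₂ ∷ [])) (substForm a b c d (v₀ ∷ v₁ ∷ v₂ ∷ []))
  substForm-mulP a b c d u₀ u₁ u₂ v₀ v₁ v₂ = list-cong₅ (by 0 refl) (by 1 refl) (by 2 refl) (by 3 refl) (by 4 refl)
    where
    module S = SymbolicForms K 10
    A = var (# 6) ; B = var (# 7) ; C = var (# 8) ; D = var (# 9)
    u v : S.Coeffs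
    u = var (# 0) ∷ var (# 1) ∷ var (# 2) ∷ []
    v = var (# 3) ∷ var (# 4) ∷ var (# 5) ∷ []
    env = u₀ ∷ u₁ ∷ u₂ ∷ v₀ ∷ v₁ ∷ v₂ ∷ a ∷ b ∷ c ∷ d ∷ []
    by : ∀ k → let l = S.coeff k (S.substForm A B C D (S.mulP u v))
                   r = S.coeff k (S.mulP (S.substForm A B C D u) (S.substForm A B C D v)) in
         ⟦ l ⟧↓ env ≡ ⟦ r ⟧↓ env → ⟦ l ⟧ env ≡ ⟦ r ⟧ env
    by k = prove env (S.coeff k (S.substForm A B C D (S.mulP u v)))
                     (S.coeff k (S.mulP (S.substForm A B C D u) (S.substForm A B C D v)))

  mulQuad : ∀ u₀ u₁ u₂ v₀ v₁ v₂ → mulP (u₀ ∷ u₁ ∷ u₂ ∷ []) (v₀ ∷ v₁ ∷ v₂ ∷ []) ≡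
    u₀ * v₀ ∷ u₀ * v₁ + u₁ * v₀ ∷ u₀ * v₂ + u₁ * v₁ + u₂ * v₀ ∷ u₁ * v₂ + u₂ * v₁ ∷ u₂ * v₂ ∷ []
  mulQuad u₀ u₁ u₂ v₀ v₁ v₂ = list-cong₅
    (+-identityʳ _)
    (cong (u₀ * v₁ +_) (+-identityʳ _))
    (trans (cong (λ t → u₀ * v₂ + (u₁ * v₁ + t)) (+-identityʳ _)) (sym (+-assoc _ _ _)))
    refl refl

  mulQuad-comm : ∀ u v → Quadratic u → Quadratic v → mulP u v ≡ mulP v u
  mulQuad-comm (u₀ ∷ u₁ ∷ u₂ ∷ []) (v₀ ∷ v₁ ∷ v₂ ∷ []) refl refl =
    trans (mulQuad u₀ u₁ u₂ v₀ v₁ v₂) (trans (list-cong₅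
      (*-comm u₀ v₀)
      (solve 4 (λ u₀ u₁ v₀ v₁ → u₀ :* v₁ :+ u₁ :* v₀ := v₀ :* u₁ :+ v₁ :* u₀) refl u₀ u₁ v₀ v₁)
      (solve 6 (λ u₀ u₁ u₂ v₀ v₁ v₂ → u₀ :* v₂ :+ u₁ :* v₁ :+ u₂ :* v₀ := v₀ :* u₂ :+ v₁ :* u₁ :+ v₂ :* u₀)
         refl u₀ u₁ u₂ v₀ v₁ v₂)
      (solve 4 (λ u₁ u₂ v₁ v₂ → u₁ :* v₂ :+ u₂ :* v₁ := v₁ :* u₂ :+ v₂ :* u₁) refl u₁ u₂ v₁ v₂)
      (*-comm u₂ v₂)) (sym (mulQuad v₀ v₁ v₂ u₀ u₁ u₂)))

  scale-addP : ∀ c p q → scale c (addP p q) ≡ addP (scale c p) (scale c q)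
  scale-addP c []      q       = refl
  scale-addP c (a ∷ p) []      = refl
  scale-addP c (a ∷ p) (b ∷ q) = cong₂ _∷_ (distribˡ c a b) (scale-addP c p q)

  scale-scale : ∀ c d p → scale c (scale d p) ≡ scale (c * d) p
  scale-scale c d []      = refl
  scale-scale c d (a ∷ p) = cong₂ _∷_ (sym (*-assoc c d a)) (scale-scale c d p)

  scale-1 : ∀ p → scale 1# p ≡ p
  scale-1 []      = refl
  scale-1 (a ∷ p) = cong₂ _∷_ (*-identityˡ a) (scale-1 p)

  mulP-scaleˡ : ∀ c p q → mulP (scale c p) q ≡ scale c (mulP p q)
  mulP-scaleˡ c []      q = refl
  mulP-scaleˡ c (a ∷ p) q = sym (trans (scale-addP c (scale a q) (0# ∷ mulP p q))
    (cong₂ addP (scale-scale c a q) (cong₂ _∷_ (zeroʳ c) (sym (mulP-scaleˡ c p q)))))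

  mulP-scaleʳ : ∀ c p q → mulP p (scale c q) ≡ scale c (mulP p q)
  mulP-scaleʳ c []      q = refl
  mulP-scaleʳ c (a ∷ p) q = sym (trans (scale-addP c (scale a q) (0# ∷ mulP p q))
    (cong₂ addP (trans (scale-scale c a q) (trans (cong (λ t → scale t q) (*-comm c a)) (sym (scale-scale a c q))))
                (cong₂ _∷_ (zeroʳ c) (sym (mulP-scaleʳ c p q)))))

  -- The polarization of the discriminant, with junk value 0# off degree 2.
  polar : List Carrier → List Carrier → Carrier
  polar (u₀ ∷ u₁ ∷ u₂ ∷ []) (v₀ ∷ v₁ ∷ v₂ ∷ []) = u₁ * v₁ - two * (u₀ * v₂ + u₂ * v₀)
  polar _ _ = 0#

  disc : List Carrier → Carrier
  disc u = polar u u

  polar-comm : ∀ u v → Quadratic u → Quadratic v → polar u v ≡ polar v u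
  polar-comm (u₀ ∷ u₁ ∷ u₂ ∷ []) (v₀ ∷ v₁ ∷ v₂ ∷ []) refl refl =
    solve 6 (λ u₀ u₁ u₂ v₀ v₁ v₂ → u₁ :* v₁ :- con (ℤ.+ 2) :* (u₀ :* v₂ :+ u₂ :* v₀) :=
      v₁ :* u₁ :- con (ℤ.+ 2) :* (v₀ :* u₂ :+ v₂ :* u₀)) refl u₀ u₁ u₂ v₀ v₁ v₂

  polar-scaleˡ : ∀ c u v → Quadratic u → Quadratic v → polar (scale c u) v ≡ c * polar u v
  polar-scaleˡ c (u₀ ∷ u₁ ∷ u₂ ∷ []) (v₀ ∷ v₁ ∷ v₂ ∷ []) refl refl =
    solve 7 (λ c u₀ u₁ u₂ v₀ v₁ v₂ → c :* u₁ :* v₁ :- con (ℤ.+ 2) :* (c :* u₀ :* v₂ :+ c :* u₂ :* v₀) :=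
      c :* (u₁ :* v₁ :- con (ℤ.+ 2) :* (u₀ :* v₂ :+ u₂ :* v₀))) refl c u₀ u₁ u₂ v₀ v₁ v₂

  disc-scale : ∀ c u → Quadratic u → disc (scale c u) ≡ c * c * disc u
  disc-scale c (u₀ ∷ u₁ ∷ u₂ ∷ []) refl =
    solve 4 (λ c u₀ u₁ u₂ → (c :* u₁) :* (c :* u₁) :- con (ℤ.+ 2) :* ((c :* u₀) :* (c :* u₂) :+ (c :* u₂) :* (c :* u₀)) :=
      c :* c :* (u₁ :* u₁ :- con (ℤ.+ 2) :* (u₀ :* u₂ :+ u₂ :* u₀))) refl c u₀ u₁ u₂

  -- The discriminant of a binary quadratic form is an invariant of weight 2; this is the
  -- polarization of that fact.
  polar-substForm : ∀ a b c d u v → Quadratic u → Quadratic v →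
    polar (substForm a b c d u) (substForm a b c d v) ≡ (a * d - b * c) * (a * d - b * c) * polar u v
  polar-substForm a b c d (u₀ ∷ u₁ ∷ u₂ ∷ []) (v₀ ∷ v₁ ∷ v₂ ∷ []) refl refl =
    trans (cong₂ polar (substQuad a b c d u₀ u₁ u₂) (substQuad a b c d v₀ v₁ v₂))
      (solve 10 (λ a b c d u₀ u₁ u₂ v₀ v₁ v₂ →
        let s₀ u₀ u₁ u₂ = u₀ :* (a :* a) :- u₁ :* (a :* b) :+ u₂ :* (b :* b)
            s₁ u₀ u₁ u₂ = u₁ :* (a :* d :+ b :* c) :- con (ℤ.+ 2) :* (u₀ :* (a :* c)) :- con (ℤ.+ 2) :* (u₂ :* (b :* d))
            s₂ u₀ u₁ u₂ = u₀ :* (c :* c) :- u₁ :* (c :* d) :+ u₂ :* (d :* d)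
        in s₁ u₀ u₁ u₂ :* s₁ v₀ v₁ v₂ :- con (ℤ.+ 2) :* (s₀ u₀ u₁ u₂ :* s₂ v₀ v₁ v₂ :+ s₂ u₀ u₁ u₂ :* s₀ v₀ v₁ v₂) :=
           (a :* d :- b :* c) :* (a :* d :- b :* c) :* (u₁ :* v₁ :- con (ℤ.+ 2) :* (u₀ :* v₂ :+ u₂ :* v₀)))
        refl a b c d u₀ u₁ u₂ v₀ v₁ v₂)

-- Coordinates and the norm on L = K ⊕ Kρ

module QuadraticExtension
  {K L : FiniteField} (ι : Embedding K L) (|L|≡|K|² : card L ≡ card K ℕ.* card K)
  (ρ : El L) (ρ∉K : ∀ x → Embedding.emb ι x ≢ ρ)
  (ν : El K) (ν≡ρ² : Embedding.emb ι ν ≡ FiniteField._*_ L ρ ρ) where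

  open FiniteField K
  open IntegerRingSolver K
  open FieldLemmas K
  open Poly K
  open BinaryForms K
  open MinPoly ι
  open Embedding ι
  open ≡-Reasoning
  private
    module L where
      open FiniteField L public
      open FieldLemmas L public
      open CommutativeRing (IntegerRingSolver.commutativeRing L) public using (ring)

  emb-0 : emb 0# ≡ L.0#
  emb-0 = RingProperties.x+x≈x⇒x≈0 L.ring _ (trans (sym (emb-+ 0# 0#)) (cong emb (+-identityʳ 0#)))

  emb-neg : ∀ x → emb (- x) ≡ L.- emb x
  emb-neg x = RingProperties.+-inverseʳ-unique L.ring _ _
    (trans (sym (emb-+ x (- x))) (trans (cong emb (-‿inverseʳ x)) emb-0))

  infix 9 ⟪_,_⟫
  ⟪_,_⟫ : Carrier → Carrier → L.Carrier
  ⟪ x , y ⟫ = emb x L.+ emb y L.* ρ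

  emb-as-⟪⟫ : ∀ x → emb x ≡ ⟪ x , 0# ⟫
  emb-as-⟪⟫ x = sym (trans (cong (λ t → emb x L.+ t L.* ρ) emb-0)
    (trans (cong (emb x L.+_) (L.zeroˡ ρ)) (L.+-identityʳ _)))

  ρ-as-⟪⟫ : ρ ≡ ⟪ 0# , 1# ⟫
  ρ-as-⟪⟫ = sym (trans (cong₂ (λ s t → s L.+ t L.* ρ) emb-0 emb-1) (trans (L.+-identityˡ _) (L.*-identityˡ ρ)))

  ⟪⟫-+ : ∀ x y x′ y′ → ⟪ x , y ⟫ L.+ ⟪ x′ , y′ ⟫ ≡ ⟪ x + x′ , y + y′ ⟫
  ⟪⟫-+ x y x′ y′ = trans (L.+-collect _ _ _ _ ρ) (sym (cong₂ (λ s t → s L.+ t L.* ρ) (emb-+ x x′) (emb-+ y y′)))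

  ⟪⟫-neg : ∀ x y → L.- ⟪ x , y ⟫ ≡ ⟪ - x , - y ⟫
  ⟪⟫-neg x y = trans (L.neg-collect _ _ ρ) (sym (cong₂ (λ s t → s L.+ t L.* ρ) (emb-neg x) (emb-neg y)))

  ⟪⟫-* : ∀ x y x′ y′ → ⟪ x , y ⟫ L.* ⟪ x′ , y′ ⟫ ≡ ⟪ x * x′ + ν * (y * y′) , x * y′ + y * x′ ⟫
  ⟪⟫-* x y x′ y′ = trans (L.*-collect _ _ _ _ ρ) (sym (cong₂ (λ s t → s L.+ t L.* ρ)
      (trans (emb-+ _ _) (cong₂ L._+_ (emb-* x x′) (trans (emb-* ν _) (cong₂ L._*_ ν≡ρ² (emb-* y y′)))))
      (trans (emb-+ _ _) (cong₂ L._+_ (emb-* x y′) (emb-* y x′)))))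

  -- Linear independence of 1 and ρ over K: if y ≠ 0, then ρ = -x/y would lie in K.
  ⟪⟫-≡0 : ∀ {x y} → ⟪ x , y ⟫ ≡ L.0# → x ≡ 0# × y ≡ 0#
  ⟪⟫-≡0 {x} {y} eq with y ≟ 0#
  ... | no y≢0 = ⊥-elim (ρ∉K (- (x * y ⁻¹)) (begin
          emb (- (x * y ⁻¹))        ≡⟨ emb-neg _ ⟩
          L.- emb (x * y ⁻¹)        ≡⟨ cong L.-_ (emb-* x (y ⁻¹)) ⟩
          L.- (emb x L.* emb (y ⁻¹)) ≡⟨ L.linear-root eq (trans (sym (emb-* y (y ⁻¹)))
                                          (trans (cong emb (⁻¹-inverse y y≢0)) emb-1)) ⟩
          ρ                         ∎))
  ... | yes refl with x ≟ 0#
  ...   | yes x≡0 = x≡0 , refl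
  ...   | no  x≢0 = ⊥-elim (L.0≢1 (begin
          L.0#                       ≡⟨ L.zeroˡ _ ⟨
          L.0# L.* emb (x ⁻¹)        ≡⟨ cong (L._* emb (x ⁻¹)) (trans (emb-as-⟪⟫ x) eq) ⟨
          emb x L.* emb (x ⁻¹)       ≡⟨ emb-* x (x ⁻¹) ⟨
          emb (x * x ⁻¹)             ≡⟨ cong emb (⁻¹-inverse x x≢0) ⟩
          emb 1#                     ≡⟨ emb-1 ⟩
          L.1#                       ∎))

  ⟪⟫-injective : ∀ {x x′ y y′} → ⟪ x , y ⟫ ≡ ⟪ x′ , y′ ⟫ → x ≡ x′ × y ≡ y′
  ⟪⟫-injective {x} {x′} {y} {y′} eq = let x-x′≡0 , y-y′≡0 = ⟪⟫-≡0 difference in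
      x-y≡0⇒x≡y x-x′≡0 , x-y≡0⇒x≡y y-y′≡0
    where
    difference : ⟪ x - x′ , y - y′ ⟫ ≡ L.0#
    difference = begin
      ⟪ x - x′ , y - y′ ⟫                ≡⟨ ⟪⟫-+ x y (- x′) (- y′) ⟨
      ⟪ x , y ⟫ L.+ ⟪ - x′ , - y′ ⟫      ≡⟨ cong (⟪ x , y ⟫ L.+_) (⟪⟫-neg x′ y′) ⟨
      ⟪ x , y ⟫ L.- ⟪ x′ , y′ ⟫          ≡⟨ cong (L._- ⟪ x′ , y′ ⟫) eq ⟩
      ⟪ x′ , y′ ⟫ L.- ⟪ x′ , y′ ⟫        ≡⟨ L.-‿inverseʳ _ ⟩
      L.0#                               ∎

  -- Abstract, as conversion checking would otherwise unfold the search through elements.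
  abstract
    coordinates : ∀ z → ∃[ x ] ∃[ y ] z ≡ ⟪ x , y ⟫
    coordinates z =
      let x , y , _ , _ , eq = ∈-cartesianProductWith⁻ ⟪_,_⟫ elements elements (pairs-complete z) in x , y , eq
      where
      pairs-complete : ∀ z → z ∈ cartesianProductWith ⟪_,_⟫ elements elements
      pairs-complete = L.unique-size⇒complete (Unique.cartesianProductWith⁺ ⟪_,_⟫ ⟪⟫-injective unique unique)
        (trans (length-cartesianProductWith ⟪_,_⟫ elements elements) (sym |L|≡|K|²))

  re im : L.Carrier → Carrier
  re z = proj₁ (coordinates z)
  im z = proj₁ (proj₂ (coordinates z))

  ⟪re,im⟫ : ∀ z → z ≡ ⟪ re z , im z ⟫
  ⟪re,im⟫ z = proj₂ (proj₂ (coordinates z))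

  norm : Carrier → Carrier → Carrier
  norm x y = x * x - ν * (y * y)

  -- `norm x y` is the product of x+yρ and x-yρ in L, which has no zero divisors.
  norm≡0 : ∀ {x y} → norm x y ≡ 0# → x ≡ 0# × y ≡ 0#
  norm≡0 {x} {y} eq = [ ⟪⟫-≡0 , (λ z≡0 → let x≡0 , -y≡0 = ⟪⟫-≡0 z≡0 in
      x≡0 , neg≡0 -y≡0) ]′
      (L.zero-product conjugates)
    where
    conjugates : ⟪ x , y ⟫ L.* ⟪ x , - y ⟫ ≡ L.0#
    conjugates = begin
      ⟪ x , y ⟫ L.* ⟪ x , - y ⟫                          ≡⟨ ⟪⟫-* x y x (- y) ⟩
      ⟪ x * x + ν * (y * - y) , x * - y + y * x ⟫        ≡⟨ cong₂ ⟪_,_⟫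
          (trans (solve 3 (λ x y n → x :* x :+ n :* (y :* :- y) := x :* x :- n :* (y :* y)) refl x y ν) eq)
          (solve 2 (λ x y → x :* :- y :+ y :* x := con (ℤ.+ 0)) refl x y) ⟩
      ⟪ 0# , 0# ⟫                                        ≡⟨ emb-as-⟪⟫ 0# ⟨
      emb 0#                                             ≡⟨ emb-0 ⟩
      L.0#                                               ∎

  -- For y = 1 this says that ν is not a square in K, and for general y that νy² is not; most later
  -- contradictions arise from it.
  norm-nonzeroʳ : ∀ {x y} → y ≢ 0# → norm x y ≢ 0#
  norm-nonzeroʳ y≢0 = y≢0 ∘ proj₂ ∘ norm≡0

  ν≢0 : ν ≢ 0#
  ν≢0 eq = norm-nonzeroʳ {0#} {1#} (0≢1 ∘ sym) (trans (cong (λ t → 0# * 0# - t * (1# * 1#)) eq)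
    (solve 0 (con (ℤ.+ 0) :* con (ℤ.+ 0) :- con (ℤ.+ 0) :* (con (ℤ.+ 1) :* con (ℤ.+ 1)) := con (ℤ.+ 0)) refl))

  -- In characteristic 2, (x-y)² = x²-y².
  square-injective : two ≡ 0# → ∀ {x y} → x * x ≡ y * y → x ≡ y
  square-injective 2≡0 {x} {y} eq = x-y≡0⇒x≡y ([ (λ p → p) , (λ p → p) ]′ (zero-product
    (linear-combination₂ 1# eq (y * (y - x)) 2≡0
      (solve 2 (λ x y → (x :- y) :* (x :- y) :- con (ℤ.+ 0) := con (ℤ.+ 1) :* (x :* x :- y :* y) :+
         y :* (y :- x) :* (con (ℤ.+ 2) :- con (ℤ.+ 0))) refl x y))))

  -- In characteristic 2 squaring is injective, hence surjective, and ν would be a square.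
  two≢0 : two ≢ 0#
  two≢0 2≡0 = norm-nonzeroʳ {√ν} {1#} (0≢1 ∘ sym) (trans (cong (λ t → √ν * √ν - t * (1# * 1#)) ν≡√ν²)
        (solve 1 (λ x → x :* x :- x :* x :* (con (ℤ.+ 1) :* con (ℤ.+ 1)) := con (ℤ.+ 0)) refl √ν))
    where
    ν∈squares : ν ∈ map (λ x → x * x) elements
    ν∈squares = unique-size⇒complete (Unique.map⁺ (square-injective 2≡0) unique) (length-map _ elements) ν
    √ν = proj₁ (∈-map⁻ _ ν∈squares)
    ν≡√ν² = proj₂ (proj₂ (∈-map⁻ _ ν∈squares))

  N : L.Carrier → Carrier
  N z = norm (re z) (im z)

  N-⟪⟫ : ∀ {z x y} → z ≡ ⟪ x , y ⟫ → N z ≡ norm x y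
  N-⟪⟫ {z} eq = let x≡ , y≡ = ⟪⟫-injective (trans (sym (⟪re,im⟫ z)) eq) in cong₂ norm x≡ y≡

  N-* : ∀ z w → N (z L.* w) ≡ N z * N w
  N-* z w = trans (N-⟪⟫ (trans (cong₂ L._*_ (⟪re,im⟫ z) (⟪re,im⟫ w)) (⟪⟫-* _ _ _ _)))
    (solve 5 (λ x y x′ y′ n →
       (x :* x′ :+ n :* (y :* y′)) :* (x :* x′ :+ n :* (y :* y′)) :- n :* ((x :* y′ :+ y :* x′) :* (x :* y′ :+ y :* x′)) :=
       (x :* x :- n :* (y :* y)) :* (x′ :* x′ :- n :* (y′ :* y′))) refl (re z) (im z) (re w) (im w) ν)

  N-emb : ∀ x → N (emb x) ≡ x * x
  N-emb x = trans (N-⟪⟫ (emb-as-⟪⟫ x)) (solve 2 (λ x n → x :* x :- n :* (con (ℤ.+ 0) :* con (ℤ.+ 0)) := x :* x) refl x ν)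

  N-1 : N L.1# ≡ 1#
  N-1 = trans (cong N (sym emb-1)) (trans (N-emb 1#) (*-identityˡ 1#))

  N-^ : ∀ z k → N (z L.^ k) ≡ N z ^ k
  N-^ z zero    = N-1
  N-^ z (suc k) = trans (N-* z _) (cong (N z *_) (N-^ z k))

  N-nonzero : ∀ {z} → z ≢ L.0# → N z ≢ 0#
  N-nonzero {z} z≢0 Nz≡0 = let x≡0 , y≡0 = norm≡0 Nz≡0 in
    z≢0 (trans (⟪re,im⟫ z) (trans (cong₂ ⟪_,_⟫ x≡0 y≡0) (trans (sym (emb-as-⟪⟫ 0#)) emb-0)))

  -- For u of norm 1, v = 1+u satisfies u·v̄ = u+1 = v. Dividing v by its first coordinate 1+p gives
  -- a = 1 and b = r/(1+p). If 1+p = 0, the norm equation forces r = 0, so u = -1 and v = ρ serves.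
  -- The normalization leaves only q+1 candidates for v, as the count of norm-one elements needs.
  hilbert90 : ∀ {u} → N u ≡ 1# → ∃[ a ] ∃[ b ]
    ((a ≡ 0# × b ≡ 1#) ⊎ a ≡ 1#) × u L.* ⟪ a , - b ⟫ ≡ ⟪ a , b ⟫
  hilbert90 {u} Nu≡1 with (1# + re u) ≟ 0#
  ... | yes 1+p≡0 = 0# , 1# , inj₁ (refl , refl) ,
      trans (cong (L._* ⟪ 0# , - 1# ⟫) (⟪re,im⟫ u)) (trans (⟪⟫-* _ _ _ _) (cong₂ ⟪_,_⟫
        (trans (cong (λ t → p * 0# + ν * (t * - 1#)) r≡0)
          (solve 2 (λ p n → p :* con (ℤ.+ 0) :+ n :* (con (ℤ.+ 0) :* :- con (ℤ.+ 1)) := con (ℤ.+ 0)) refl p ν))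
        (linear-combination₁ (- 1#) 1+p≡0
          (solve 2 (λ p r → p :* :- con (ℤ.+ 1) :+ r :* con (ℤ.+ 0) :- con (ℤ.+ 1) :=
             (:- con (ℤ.+ 1)) :* (con (ℤ.+ 1) :+ p :- con (ℤ.+ 0))) refl p r))))
    where
    p = re u
    r = im u
    r≡0 : r ≡ 0#
    r≡0 = proj₂ (norm≡0 {0#} {r} (linear-combination₂ 1# Nu≡1 (1# - p) 1+p≡0
      (solve 3 (λ p r n → (con (ℤ.+ 0) :* con (ℤ.+ 0) :- n :* (r :* r)) :- con (ℤ.+ 0) :=
        con (ℤ.+ 1) :* (p :* p :- n :* (r :* r) :- con (ℤ.+ 1)) :+
        (con (ℤ.+ 1) :- p) :* (con (ℤ.+ 1) :+ p :- con (ℤ.+ 0))) refl p r ν)))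
  ... | no 1+p≢0 = 1# , b , inj₂ refl ,
      trans (cong (L._* ⟪ 1# , - b ⟫) (⟪re,im⟫ u)) (trans (⟪⟫-* _ _ _ _) (cong₂ ⟪_,_⟫
        (*-cancelˡ 1+p≢0 (linear-combination₂ 1# Nu≡1 (ν * r) tb≡r
          (solve 4 (λ p r b n → (con (ℤ.+ 1) :+ p) :* (p :* con (ℤ.+ 1) :+ n :* (r :* :- b)) :- (con (ℤ.+ 1) :+ p) :* con (ℤ.+ 1) :=
             con (ℤ.+ 1) :* (p :* p :- n :* (r :* r) :- con (ℤ.+ 1)) :+ n :* r :* (r :- (con (ℤ.+ 1) :+ p) :* b)) refl p r b ν)))
        (linear-combination₁ 1# tb≡r
          (solve 3 (λ p r b → p :* :- b :+ r :* con (ℤ.+ 1) :- b := con (ℤ.+ 1) :* (r :- (con (ℤ.+ 1) :+ p) :* b)) refl p r b))))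
    where
    p = re u
    r = im u
    b = r * (1# + p) ⁻¹
    tb≡r : r ≡ (1# + p) * b
    tb≡r = linear-combination₁ (- r) (⁻¹-inverse (1# + p) 1+p≢0)
      (solve 3 (λ t r d → r :- t :* (r :* d) := (:- r) :* (t :* d :- con (ℤ.+ 1))) refl (1# + p) r ((1# + p) ⁻¹))

  -- The norm of ζ generates the multiplicative group of K

  module NormOfGenerator (ζ : El L) (generates : Generator L ζ) where

    γ : Carrier
    γ = N ζ

    ρ≢0 : ρ ≢ L.0#
    ρ≢0 ρ≡0 = ρ∉K 0# (trans emb-0 (sym ρ≡0))

    -- The powers of 0 are 1 and 0, both in K, so ρ would not be among them.
    ζ≢0 : ζ ≢ L.0#
    ζ≢0 ζ≡0 = not-power (generates ρ ρ≢0)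
      where
      not-power : ¬ (∃[ i ] ζ L.^ i ≡ ρ)
      not-power (zero  , 1≡ρ)  = ρ∉K 1# (trans emb-1 1≡ρ)
      not-power (suc i , ζ^≡ρ) = ρ≢0 (trans (sym ζ^≡ρ) (trans (cong (L._* (ζ L.^ i)) ζ≡0) (L.zeroˡ _)))

    γ≢0 : γ ≢ 0#
    γ≢0 = N-nonzero ζ≢0

    private
      unit : Carrier → Carrier → L.Carrier
      unit a b = ⟪ a , b ⟫ L.* (⟪ a , - b ⟫ L.⁻¹)

      units : List L.Carrier
      units = unit 0# 1# ∷ map (unit 1#) elements

      norm1∈units : ∀ {u} → N u ≡ 1# → u ∈ units
      norm1∈units {u} Nu≡1 = let a , b , shape , eq = hilbert90 Nu≡1 in member a b shape eq
        where
        member : ∀ a b → (a ≡ 0# × b ≡ 1#) ⊎ a ≡ 1# → u L.* ⟪ a , - b ⟫ ≡ ⟪ a , b ⟫ → u ∈ units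
        member _ _ (inj₁ (refl , refl)) eq = here (L.divide eq λ v̄≡0 → 0≢1 (sym (neg≡0 (proj₂ (⟪⟫-≡0 v̄≡0)))))
        member _ b (inj₂ refl) eq = there (subst (_∈ map (unit 1#) elements)
          (sym (L.divide eq λ v̄≡0 → 0≢1 (sym (proj₁ (⟪⟫-≡0 v̄≡0))))) (∈-map⁺ (unit 1#) (complete b)))

      -- If γ^m = 1, then ζᵏ is ζ^(k mod m) times an element of norm 1.
      powers-times-units : ℕ → List L.Carrier
      powers-times-units m = L.0# ∷ cartesianProductWith (λ j u → (ζ L.^ j) L.* u) (upTo m) units

      covered : ∀ m → γ ^ suc m ≡ 1# → ∀ z → z ∈ powers-times-units (suc m)
      covered m γ^m≡1 z = [ here , nonzero-covered ]′ (toSum (z L.≟ L.0#))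
        where
        nonzero-covered : z ≢ L.0# → z ∈ powers-times-units (suc m)
        nonzero-covered z≢0 = there (subst (_∈ cartesianProductWith (λ j u → (ζ L.^ j) L.* u) (upTo (suc m)) units) (sym z≡)
            (∈-cartesianProductWith⁺ _ (∈-upTo⁺ (ℕ÷.m%n<n k (suc m))) (norm1∈units Nu≡1)))
          where
          k = proj₁ (generates z z≢0)
          r = k ℕ÷.% suc m
          d = k ℕ÷./ suc m
          u = ζ L.^ (d ℕ.* suc m)
          z≡ : z ≡ (ζ L.^ r) L.* u
          z≡ = trans (sym (proj₂ (generates z z≢0)))
            (trans (cong (ζ L.^_) (ℕ÷.m≡m%n+[m/n]*n k (suc m))) (L.^-+ ζ r (d ℕ.* suc m)))
          Nu≡1 : N u ≡ 1#
          Nu≡1 = trans (N-^ ζ (d ℕ.* suc m)) (trans (^-* γ d (suc m)) (trans (cong (_^ d) γ^m≡1) (1^n≡1 d)))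

    γ-order-minimal : ∀ m → γ ^ suc m ≡ 1# → size ℕ.≤ suc (suc m)
    γ-order-minimal m γ^m≡1 = ℕₚ.≮⇒≥ λ 2+m<q → ℕₚ.<⇒≱ (1+[1+m][1+q]<q² 2+m<q)
      (subst₂ ℕ._≤_ |L|≡|K|²
        (cong suc (trans (length-cartesianProductWith _ (upTo (suc m)) units)
          (cong₂ ℕ._*_ (length-applyUpTo (λ i → i) (suc m)) (cong suc (length-map (unit 1#) elements)))))
        (unique-⊆⇒length≤ L.unique (λ {z} _ → covered m γ^m≡1 z)))

    ^-cancel : ∀ {x i j} → x ≢ 0# → i ℕ.≤ j → x ^ i ≡ x ^ j → x ^ (j ∸ i) ≡ 1#
    ^-cancel {x} {i} {j} x≢0 i≤j eq = *-cancelˡ (^-nonzero i x≢0) (begin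
      x ^ i * x ^ (j ∸ i)   ≡⟨ ^-+ x i (j ∸ i) ⟨
      x ^ (i ℕ.+ (j ∸ i))   ≡⟨ cong (x ^_) (ℕₚ.m+[n∸m]≡n i≤j) ⟩
      x ^ j                 ≡⟨ eq ⟨
      x ^ i                 ≡⟨ *-identityʳ _ ⟨
      x ^ i * 1#            ∎)

    private
      value : Fin (suc size) → Carrier
      value Fin.zero    = 0#
      value (Fin.suc i) = γ ^ toℕ i

      position : Fin (suc size) → Fin size
      position i = Any.index (complete (value i))

      position-injective : ∀ {i j} → position i ≡ position j → value i ≡ value j
      position-injective {i} {j} eq = begin
        value i                          ≡⟨ lookup-index (complete (value i)) ⟩
        lookup elements (position i)     ≡⟨ cong (lookup elements) eq ⟩
        lookup elements (position j)     ≡⟨ lookup-index (complete (value j)) ⟨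
        value j                          ∎

    -- Pigeonhole on the q+1 values 0, γ⁰, ..., γ^(q-1): as 0 is not a power of γ, two powers
    -- coincide, with a period at most q-1. Together with the lower bound `γ-order-minimal` the
    -- period is exactly q-1, which takes the place of Fermat's theorem.
    γ-periodic : ∃[ m ] suc m ℕ.< size × γ ^ suc m ≡ 1#
    γ-periodic = let i , j , i<j , eq = Finₚ.pigeonhole (ℕₚ.n<1+n size) position in
        period i j i<j (position-injective {i} {j} eq)
      where
      period : ∀ i j → i Fin.< j → value i ≡ value j → ∃[ m ] suc m ℕ.< size × γ ^ suc m ≡ 1#
      period Fin.zero    (Fin.suc j) _           eq = ⊥-elim (^-nonzero (toℕ j) γ≢0 (sym eq))
      period (Fin.suc i) (Fin.suc j) (ℕ.s≤s i<j) eq =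
          toℕ j ∸ suc (toℕ i) ,
          ℕₚ.≤-<-trans (ℕₚ.≤-trans (ℕₚ.≤-reflexive suc-∸) (ℕₚ.m∸n≤m (toℕ j) (toℕ i))) (Finₚ.toℕ<n j) ,
          trans (cong (γ ^_) suc-∸) (^-cancel γ≢0 (ℕₚ.<⇒≤ i<j) eq)
        where
        suc-∸ : suc (toℕ j ∸ suc (toℕ i)) ≡ toℕ j ∸ toℕ i
        suc-∸ = sym (ℕₚ.+-∸-assoc 1 i<j)

    γ^[q-1]≡1 : γ ^ (size ∸ 1) ≡ 1#
    γ^[q-1]≡1 = let m , 1+m<q , γ^m≡1 = γ-periodic in
      trans (cong (λ q → γ ^ (q ∸ 1)) (ℕₚ.≤-antisym (γ-order-minimal m γ^m≡1) 1+m<q)) γ^m≡1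

    γ-order : ∀ {m} → 1 ℕ.≤ m → γ ^ m ≡ 1# → size ∸ 1 ℕ.≤ m
    γ-order {suc m} _ γ^m≡1 = ℕₚ.∸-monoˡ-≤ 1 (γ-order-minimal m γ^m≡1)

    γ^-distinct : ∀ {i j} → i ℕ.< j → j ∸ i ℕ.< size ∸ 1 → γ ^ i ≢ γ ^ j
    γ^-distinct i<j j-i<q-1 eq =
      ℕₚ.<⇒≱ j-i<q-1 (γ-order (ℕₚ.m<n⇒0<n∸m i<j) (^-cancel γ≢0 (ℕₚ.<⇒≤ i<j) eq))

    abstract
      -- The elements 0, γ⁰, ..., γ^(q-2) are pairwise distinct and there are q of them.
      γ-generates : ∀ {x} → x ≢ 0# → ∃[ k ] k ℕ.< size ∸ 1 × x ≡ γ ^ k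
      γ-generates {x} x≢0 = power (unique-size⇒complete
          (Allₚ.applyUpTo⁺₂ (γ ^_) (size ∸ 1) (λ k → ^-nonzero k γ≢0 ∘ sym) ∷
           Unique.applyUpTo⁺₁ (γ ^_) (size ∸ 1) (λ {i} {j} i<j j<q-1 → γ^-distinct i<j (ℕₚ.≤-<-trans (ℕₚ.m∸n≤m j i) j<q-1)))
          (trans (cong suc (length-applyUpTo (γ ^_) (size ∸ 1)))
            (ℕₚ.m+[n∸m]≡n (ℕₚ.≤-trans (ℕ.s≤s ℕ.z≤n) (proj₁ (proj₂ γ-periodic))))) x)
        where
        power : x ∈ 0# ∷ applyUpTo (γ ^_) (size ∸ 1) → ∃[ k ] k ℕ.< size ∸ 1 × x ≡ γ ^ k
        power (here x≡0) = ⊥-elim (x≢0 x≡0)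
        power (there x∈) = ∈-applyUpTo⁻ (γ ^_) x∈

    square-or-γ-times-square : ∀ {x} → x ≢ 0# → ∃[ w ] (x ≡ w * w ⊎ x ≡ γ * (w * w))
    square-or-γ-times-square x≢0 = let k , _ , x≡γ^k = γ-generates x≢0 ; h , k-parity = parity k in
        γ ^ h , [ (λ k≡2h → inj₁ (trans x≡γ^k (trans (cong (γ ^_) k≡2h) (^-+ γ h h))))
                , (λ k≡1+2h → inj₂ (trans x≡γ^k (trans (cong (γ ^_) k≡1+2h) (cong (γ *_) (^-+ γ h h))))) ]′ k-parity

    -- A nonzero element is a square or γ times a square, and ν is of the second kind. If D is too,
    -- then Dν is a square e², and y = e/ν gives D = νy².
    square-or-ν-square : ∀ D → (∃[ w ] D ≡ w * w) ⊎ (∃[ y ] y ≢ 0# × D ≡ ν * (y * y))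
    square-or-ν-square D = [ (λ D≡0 → inj₁ (0# , trans D≡0 (sym (zeroˡ 0#)))) , nonzero ]′ (toSum (D ≟ 0#))
      where
      both-odd : D ≢ 0# → ∀ {w v} → D ≡ γ * (w * w) → ν ≡ γ * (v * v) → ∃[ y ] y ≢ 0# × D ≡ ν * (y * y)
      both-odd D≢0 {w} {v} D≡ ν≡ = y , (λ y≡0 → D≢0 (trans D≡νy² (trans (cong (λ t → ν * (t * t)) y≡0)
                      (solve 1 (λ n → n :* (con (ℤ.+ 0) :* con (ℤ.+ 0)) := con (ℤ.+ 0)) refl ν)))) , D≡νy²
        where
        e = γ * (w * v)
        y = e * ν ⁻¹
        Dν≡e² : D * ν ≡ e * e
        Dν≡e² = trans (cong₂ _*_ D≡ ν≡)
          (solve 3 (λ g a b → g :* (a :* a) :* (g :* (b :* b)) := g :* (a :* b) :* (g :* (a :* b))) refl γ w v)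
        D≡νy² : D ≡ ν * (y * y)
        D≡νy² = *-cancelˡ ν≢0 (linear-combination₂ 1# Dν≡e² (- (e * e * (ν * ν ⁻¹ + 1#))) (⁻¹-inverse ν ν≢0)
          (solve 4 (λ D n e d → n :* D :- n :* (n :* (e :* d :* (e :* d))) :=
             con (ℤ.+ 1) :* (D :* n :- e :* e) :+ (:- (e :* e :* (n :* d :+ con (ℤ.+ 1)))) :* (n :* d :- con (ℤ.+ 1))) refl D ν e (ν ⁻¹)))
      ν-nonsquare : ∀ w → ν ≢ w * w
      ν-nonsquare w ν≡w² = norm-nonzeroʳ {w} {1#} (0≢1 ∘ sym) (linear-combination₁ (- 1#) ν≡w²
        (solve 2 (λ n g → (g :* g :- n :* (con (ℤ.+ 1) :* con (ℤ.+ 1))) :- con (ℤ.+ 0) :=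
           (:- con (ℤ.+ 1)) :* (n :- g :* g)) refl ν w))
      nonzero : D ≢ 0# → (∃[ w ] D ≡ w * w) ⊎ (∃[ y ] y ≢ 0# × D ≡ ν * (y * y))
      nonzero D≢0 = let w , D-shape = square-or-γ-times-square D≢0 ; v , ν-shape = square-or-γ-times-square ν≢0 in
        [ (λ D≡w² → inj₁ (w , D≡w²))
        , (λ D≡γw² → [ (λ ν≡v² → ⊥-elim (ν-nonsquare v ν≡v²)) , (λ ν≡γv² → inj₂ (both-odd D≢0 D≡γw² ν≡γv²)) ]′ ν-shape)
        ]′ D-shape

  -- Minimal polynomials of x+yρ and the action on them

  -- The form (X-αY)(X-ᾱY) for α = x+yρ, that is, the norm of X-αY.
  quad : Carrier → Carrier → List Carrier
  quad x y = norm x y ∷ - (two * x) ∷ 1# ∷ []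

  eval-∷ : ∀ {x y u v} a h → eval h ⟪ x , y ⟫ ≡ ⟪ u , v ⟫ →
           eval (a ∷ h) ⟪ x , y ⟫ ≡ ⟪ a + (x * u + ν * (y * v)) , 0# + (x * v + y * u) ⟫
  eval-∷ {x} {y} a h eq = trans (cong₂ L._+_ (emb-as-⟪⟫ a) (trans (cong (⟪ x , y ⟫ L.*_) eq) (⟪⟫-* x y _ _))) (⟪⟫-+ _ _ _ _)

  eval₁ : ∀ {x y} c → eval (c ∷ []) ⟪ x , y ⟫ ≡ ⟪ c , 0# ⟫
  eval₁ {x} {y} c = trans (eval-∷ c [] (trans (sym emb-0) (emb-as-⟪⟫ 0#))) (cong₂ ⟪_,_⟫
    (solve 4 (λ c x y n → c :+ (x :* con (ℤ.+ 0) :+ n :* (y :* con (ℤ.+ 0))) := c) refl c x y ν)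
    (solve 2 (λ x y → con (ℤ.+ 0) :+ (x :* con (ℤ.+ 0) :+ y :* con (ℤ.+ 0)) := con (ℤ.+ 0)) refl x y))

  eval₂ : ∀ {x y} b c → eval (b ∷ c ∷ []) ⟪ x , y ⟫ ≡ ⟪ b + c * x , c * y ⟫
  eval₂ {x} {y} b c = trans (eval-∷ b (c ∷ []) (eval₁ c)) (cong₂ ⟪_,_⟫
    (solve 5 (λ b c x y n → b :+ (x :* c :+ n :* (y :* con (ℤ.+ 0))) := b :+ c :* x) refl b c x y ν)
    (solve 3 (λ c x y → con (ℤ.+ 0) :+ (x :* con (ℤ.+ 0) :+ y :* c) := c :* y) refl c x y))

  eval₃ : ∀ {x y} a b c → eval (a ∷ b ∷ c ∷ []) ⟪ x , y ⟫ ≡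
    ⟪ a + b * x + c * (x * x + ν * (y * y)) , y * (b + two * (c * x)) ⟫
  eval₃ {x} {y} a b c = trans (eval-∷ a (b ∷ c ∷ []) (eval₂ b c)) (cong₂ ⟪_,_⟫
    (solve 6 (λ a b c x y n → a :+ (x :* (b :+ c :* x) :+ n :* (y :* (c :* y))) :=
       a :+ b :* x :+ c :* (x :* x :+ n :* (y :* y))) refl a b c x y ν)
    (solve 4 (λ b c x y → con (ℤ.+ 0) :+ (x :* (c :* y) :+ y :* (b :+ c :* x)) :=
       y :* (b :+ con (ℤ.+ 2) :* (c :* x))) refl b c x y))

  quad-root : ∀ x y → eval (quad x y) ⟪ x , y ⟫ ≡ L.0#
  quad-root x y = begin
    eval (quad x y) ⟪ x , y ⟫  ≡⟨ eval₃ (norm x y) (- (two * x)) 1# ⟩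
    ⟪ norm x y + - (two * x) * x + 1# * (x * x + ν * (y * y)) , y * (- (two * x) + two * (1# * x)) ⟫
      ≡⟨ cong₂ ⟪_,_⟫
           (solve 3 (λ x y n → (x :* x :- n :* (y :* y)) :+ :- (con (ℤ.+ 2) :* x) :* x :+ con (ℤ.+ 1) :* (x :* x :+ n :* (y :* y))
              := con (ℤ.+ 0)) refl x y ν)
           (solve 2 (λ x y → y :* (:- (con (ℤ.+ 2) :* x) :+ con (ℤ.+ 2) :* (con (ℤ.+ 1) :* x)) := con (ℤ.+ 0)) refl x y) ⟩
    ⟪ 0# , 0# ⟫                ≡⟨ emb-as-⟪⟫ 0# ⟨
    emb 0#                     ≡⟨ emb-0 ⟩
    L.0#                       ∎

  -- A nonzero constant has value c, and a linear polynomial has ρ-coordinate cy at x+yρ; neither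
  -- vanishes.
  nonzero-root-degree : ∀ {x y} → y ≢ 0# → ∀ p {c} → c ≢ 0# → eval (p ++ [ c ]) ⟪ x , y ⟫ ≡ L.0# → 3 ℕ.≤ length (p ++ [ c ])
  nonzero-root-degree y≢0 []      {c} c≢0 eq = ⊥-elim (c≢0 (proj₁ (⟪⟫-≡0 (trans (sym (eval₁ c)) eq))))
  nonzero-root-degree y≢0 (b ∷ []) {c} c≢0 eq = ⊥-elim (*-nonzero c≢0 y≢0 (proj₂ (⟪⟫-≡0 (trans (sym (eval₂ b c)) eq))))
  nonzero-root-degree y≢0 (_ ∷ _ ∷ [])    _ _ = ℕₚ.≤-refl
  nonzero-root-degree y≢0 (_ ∷ _ ∷ _ ∷ _) _ _ = ℕ.s≤s (ℕ.s≤s (ℕ.s≤s ℕ.z≤n))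

  quad-isMinPoly : ∀ {x y} → y ≢ 0# → IsMinPoly ⟪ x , y ⟫ (quad x y)
  quad-isMinPoly {x} {y} y≢0 = (norm x y ∷ - (two * x) ∷ [] , refl) , quad-root x y ,
    λ { _ (p , c , c≢0 , refl) eq → nonzero-root-degree y≢0 p c≢0 eq }

  -- Comparison with `quad x y` limits the degree to 2. The ρ-coordinate of the value at x+yρ then
  -- determines the middle coefficient, and the other coordinate the constant one.
  isMinPoly⇒quad : ∀ {x y h} → y ≢ 0# → IsMinPoly ⟪ x , y ⟫ h → h ≡ quad x y
  isMinPoly⇒quad {x} {y} y≢0 ((p , refl) , root , minimal) =
      monic-quadratic p (ℕₚ.≤-antisym (minimal (quad x y) (norm x y ∷ - (two * x) ∷ [] , 1# , 0≢1 ∘ sym , refl) (quad-root x y))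
                                      (nonzero-root-degree y≢0 p (0≢1 ∘ sym) root)) root
    where
    monic-quadratic : ∀ p → length (p ++ [ 1# ]) ≡ 3 → eval (p ++ [ 1# ]) ⟪ x , y ⟫ ≡ L.0# → p ++ [ 1# ] ≡ quad x y
    monic-quadratic (a ∷ b ∷ [])        _  root =
        cong₂ (λ s t → s ∷ t ∷ 1# ∷ []) a≡ b≡
      where
      roots = ⟪⟫-≡0 (trans (sym (eval₃ a b 1#)) root)
      b+2x≡0 : b + two * (1# * x) ≡ 0#
      b+2x≡0 = *-cancelˡ y≢0 (trans (proj₂ roots) (sym (zeroʳ y)))
      b≡ : b ≡ - (two * x)
      b≡ = linear-combination₁ 1# b+2x≡0 (solve 2 (λ b x → b :- (:- (con (ℤ.+ 2) :* x)) :=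
             con (ℤ.+ 1) :* (b :+ con (ℤ.+ 2) :* (con (ℤ.+ 1) :* x) :- con (ℤ.+ 0))) refl b x)
      a≡ : a ≡ norm x y
      a≡ = linear-combination₂ 1# (proj₁ roots) (- x) b+2x≡0
        (solve 5 (λ a b x y n → a :- (x :* x :- n :* (y :* y)) :=
           con (ℤ.+ 1) :* (a :+ b :* x :+ con (ℤ.+ 1) :* (x :* x :+ n :* (y :* y)) :- con (ℤ.+ 0)) :+
           (:- x) :* (b :+ con (ℤ.+ 2) :* (con (ℤ.+ 1) :* x) :- con (ℤ.+ 0))) refl a b x y ν)
    monic-quadratic []                  ()
    monic-quadratic (_ ∷ [])            ()
    monic-quadratic (_ ∷ _ ∷ _ ∷ [])    ()
    monic-quadratic (_ ∷ _ ∷ _ ∷ _ ∷ _) ()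

  disc-quad : ∀ x y → disc (quad x y) ≡ ν * ((two * y) * (two * y))
  disc-quad x y = solve 3 (λ x y n → let 2x = :- (con (ℤ.+ 2) :* x) ; c = x :* x :- n :* (y :* y) in
    2x :* 2x :- con (ℤ.+ 2) :* (c :* con (ℤ.+ 1) :+ con (ℤ.+ 1) :* c) :=
    n :* ((con (ℤ.+ 2) :* y) :* (con (ℤ.+ 2) :* y))) refl x y ν

  disc-mulP : ∀ a b c d → disc (mulP (a ∷ b ∷ []) (c ∷ d ∷ [])) ≡ (a * d - b * c) * (a * d - b * c)
  disc-mulP = solve 4 (λ a b c d →
    let u₀ = a :* c :+ con (ℤ.+ 0) ; u₁ = a :* d :+ (b :* c :+ con (ℤ.+ 0)) ; u₂ = b :* d in
    u₁ :* u₁ :- con (ℤ.+ 2) :* (u₀ :* u₂ :+ u₂ :* u₀) := (a :* d :- b :* c) :* (a :* d :- b :* c)) refl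

  quad-monic : ∀ x y → MonicForm (quad x y)
  quad-monic x y = norm x y ∷ - (two * x) ∷ [] , [] , [] , refl

  -- A product of two linear forms has a square discriminant, while here the discriminant is ν(2y)².
  quad-irreducible : ∀ x {y} → y ≢ 0# → IrreducibleQuadratic (quad x y)
  quad-irreducible x {y} y≢0 = refl , λ where
    (a ∷ b ∷ []) (c ∷ d ∷ []) refl refl eq →
      norm-nonzeroʳ {a * d - b * c} (*-nonzero two≢0 y≢0)
        (linear-combination₁ 1# (trans (sym (disc-mulP a b c d)) (trans (cong disc (sym eq)) (disc-quad x y)))
          (solve 2 (λ s t → (s :- t) :- con (ℤ.+ 0) := con (ℤ.+ 1) :* (s :- t)) refl _ _))

  -- The hypotheses are the two coordinates of aα+b = α′(cα+d) for α = x+yρ and α′ = x′+y′ρ: the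
  -- matrix moves α to α′. Substituting into the norm of X-αY gives the norm of (cα+d)X-(aα+b)Y =
  -- (cα+d)(X-α′Y).
  substForm-quad : ∀ {a b c d x y x′ y′} →
    a * x + b ≡ x′ * (c * x + d) + ν * (y′ * (c * y)) →
    a * y ≡ x′ * (c * y) + y′ * (c * x + d) →
    substForm a b c d (quad x y) ≡ scale (norm (c * x + d) (c * y)) (quad x′ y′)
  substForm-quad {a} {b} {c} {d} {x} {y} {x′} {y′} h₁ h₂ = trans (substQuad a b c d _ _ _) (list-cong₃
      (trans (solve 5 (λ a b x y n →
                 (x :* x :- n :* (y :* y)) :* (a :* a) :- (:- (con (ℤ.+ 2) :* x)) :* (a :* b) :+ con (ℤ.+ 1) :* (b :* b) :=
                 (a :* x :+ b) :* (a :* x :+ b) :- n :* ((a :* y) :* (a :* y))) refl a b x y ν)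
        (trans (cong₂ norm h₁ h₂)
          (solve 5 (λ x′ y′ m k n → let e = x′ :* m :+ n :* (y′ :* k) ; f = x′ :* k :+ y′ :* m in
             e :* e :- n :* (f :* f) := (m :* m :- n :* (k :* k)) :* (x′ :* x′ :- n :* (y′ :* y′)))
             refl x′ y′ (c * x + d) (c * y) ν)))
      (trans (solve 7 (λ a b c d x y n →
                 (:- (con (ℤ.+ 2) :* x)) :* (a :* d :+ b :* c) :- con (ℤ.+ 2) :* ((x :* x :- n :* (y :* y)) :* (a :* c))
                   :- con (ℤ.+ 2) :* (con (ℤ.+ 1) :* (b :* d)) :=
                 :- (con (ℤ.+ 2) :* ((a :* x :+ b) :* (c :* x :+ d) :- n :* ((a :* y) :* (c :* y))))) refl a b c d x y ν)
        (trans (cong₂ (λ e f → - (two * (e * (c * x + d) - ν * (f * (c * y))))) h₁ h₂)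
          (solve 5 (λ x′ y′ m k n → let e = x′ :* m :+ n :* (y′ :* k) ; f = x′ :* k :+ y′ :* m in
             :- (con (ℤ.+ 2) :* (e :* m :- n :* (f :* k))) := (m :* m :- n :* (k :* k)) :* (:- (con (ℤ.+ 2) :* x′)))
             refl x′ y′ (c * x + d) (c * y) ν)))
      (solve 5 (λ c d x y n →
         (x :* x :- n :* (y :* y)) :* (c :* c) :- (:- (con (ℤ.+ 2) :* x)) :* (c :* d) :+ con (ℤ.+ 1) :* (d :* d) :=
         ((c :* x :+ d) :* (c :* x :+ d) :- n :* ((c :* y) :* (c :* y))) :* con (ℤ.+ 1)) refl c d x y ν))

  -- Invariants of a pair of quadratic factors

  x²-ν : List Carrier
  x²-ν = - ν ∷ 0# ∷ 1# ∷ []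

  x²-ν≡quad : x²-ν ≡ quad 0# 1#
  x²-ν≡quad = list-cong₃
    (solve 1 (λ n → :- n := con (ℤ.+ 0) :* con (ℤ.+ 0) :- n :* (con (ℤ.+ 1) :* con (ℤ.+ 1))) refl ν)
    (solve 0 (con (ℤ.+ 0) := :- (con (ℤ.+ 2) :* con (ℤ.+ 0))) refl) refl

  private
    coefficientwise : ∀ {a b c d e a′ b′ c′ d′ e′ : Carrier} →
      _≡_ {A = List Carrier} (a ∷ b ∷ c ∷ d ∷ e ∷ []) (a′ ∷ b′ ∷ c′ ∷ d′ ∷ e′ ∷ []) →
      a ≡ a′ × b ≡ b′ × c ≡ c′ × d ≡ d′ × e ≡ e′
    coefficientwise refl = refl , refl , refl , refl , refl

    SameInvariants : List Carrier → List Carrier → List Carrier → Set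
    SameInvariants g h k = polar x²-ν g ≡ polar h k × disc x²-ν * disc g ≡ disc h * disc k

    -- Since x²-νy² is monic, the top three coefficients of the product allow it to be cancelled,
    -- leaving g = ck; by bilinearity the scalar c can be moved from one factor to the other.
    proportional-factor : ∀ g h k → Quadratic g → Quadratic h → Quadratic k → ∀ c → h ≡ scale c x²-ν →
      mulP x²-ν g ≡ mulP h k → SameInvariants g h k
    proportional-factor g@(g₀ ∷ g₁ ∷ g₂ ∷ []) h k@(k₀ ∷ k₁ ∷ k₂ ∷ []) refl _ refl c refl eq =
        (begin
          polar x²-ν g              ≡⟨ cong (polar x²-ν) g≡ck ⟩
          polar x²-ν (scale c k)    ≡⟨ polar-comm x²-ν (scale c k) refl refl ⟩
          polar (scale c k) x²-ν    ≡⟨ polar-scaleˡ c k x²-ν refl refl ⟩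
          c * polar k x²-ν          ≡⟨ cong (c *_) (polar-comm k x²-ν refl refl) ⟩
          c * polar x²-ν k          ≡⟨ polar-scaleˡ c x²-ν k refl refl ⟨
          polar h k                 ∎) ,
        (begin
          disc x²-ν * disc g              ≡⟨ cong (λ t → disc x²-ν * disc t) g≡ck ⟩
          disc x²-ν * disc (scale c k)    ≡⟨ cong (disc x²-ν *_) (disc-scale c k refl) ⟩
          disc x²-ν * (c * c * disc k)    ≡⟨ solve 3 (λ d c k → d :* (c :* c :* k) := c :* c :* d :* k) refl (disc x²-ν) c (disc k) ⟩
          c * c * disc x²-ν * disc k      ≡⟨ cong (_* disc k) (disc-scale c x²-ν refl) ⟨
          disc h * disc k                 ∎)
      where
      coefficients = coefficientwise (trans (sym (mulQuad (- ν) 0# 1# g₀ g₁ g₂))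
        (trans eq (mulQuad (c * - ν) (c * 0#) (c * 1#) k₀ k₁ k₂)))
      e₂ = proj₁ (proj₂ (proj₂ coefficients))
      e₃ = proj₁ (proj₂ (proj₂ (proj₂ coefficients)))
      e₄ = proj₂ (proj₂ (proj₂ (proj₂ coefficients)))
      g≡ck : g ≡ scale c k
      g≡ck = list-cong₃
        (linear-combination₂ 1# e₂ ν e₄ (solve 8 (λ g₀ g₁ g₂ c k₀ k₁ k₂ n → let o = con (ℤ.+ 1) ; z = con (ℤ.+ 0) in
           g₀ :- c :* k₀ := o :* ((:- n) :* g₂ :+ z :* g₁ :+ o :* g₀ :- (c :* :- n :* k₂ :+ c :* z :* k₁ :+ c :* o :* k₀)) :+
             n :* (o :* g₂ :- c :* o :* k₂)) refl g₀ g₁ g₂ c k₀ k₁ k₂ ν))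
        (linear-combination₁ 1# e₃ (solve 5 (λ g₁ g₂ c k₁ k₂ → let o = con (ℤ.+ 1) ; z = con (ℤ.+ 0) in
           g₁ :- c :* k₁ := o :* (z :* g₂ :+ o :* g₁ :- (c :* z :* k₂ :+ c :* o :* k₁))) refl g₁ g₂ c k₁ k₂))
        (linear-combination₁ 1# e₄ (solve 3 (λ g₂ c k₂ → let o = con (ℤ.+ 1) in
           g₂ :- c :* k₂ := o :* (o :* g₂ :- c :* o :* k₂)) refl g₂ c k₂))

    -- The hypothesis is h(ρ,1) = 0 in coordinates, because h(ρ,1) = (h₀+νh₂) + h₁ρ.
    vanishing-at-ρ : ∀ {h₀ h₁ h₂} → h₀ + ν * h₂ ≡ 0# × h₁ ≡ 0# → h₀ ∷ h₁ ∷ h₂ ∷ [] ≡ scale h₂ x²-ν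
    vanishing-at-ρ {h₀} {h₁} {h₂} (e₀ , e₁) = list-cong₃
      (linear-combination₁ 1# e₀ (solve 3 (λ h₀ h₂ n → h₀ :- h₂ :* :- n := con (ℤ.+ 1) :* (h₀ :+ n :* h₂ :- con (ℤ.+ 0))) refl h₀ h₂ ν))
      (trans e₁ (sym (zeroʳ h₂))) (sym (*-identityʳ h₂))

  -- Evaluating at ρ shows that one of h, k is proportional to x²−νy².
  factorization-invariants : ∀ g h k → Quadratic g → Quadratic h → Quadratic k → mulP x²-ν g ≡ mulP h k →
    polar x²-ν g ≡ polar h k × disc x²-ν * disc g ≡ disc h * disc k
  factorization-invariants g@(g₀ ∷ g₁ ∷ g₂ ∷ []) h@(h₀ ∷ h₁ ∷ h₂ ∷ []) k@(k₀ ∷ k₁ ∷ k₂ ∷ []) refl refl refl eq =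
      [ (λ h≡0 → proportional-factor g h k refl refl refl h₂ (vanishing-at-ρ (⟪⟫-≡0 h≡0)) eq)
      , (λ k≡0 → let p , d = proportional-factor g k h refl refl refl k₂ (vanishing-at-ρ (⟪⟫-≡0 k≡0))
                               (trans eq (mulQuad-comm h k refl refl))
                 in trans p (polar-comm k h refl refl) , trans d (*-comm (disc k) (disc h)))
      ]′ (L.zero-product product-vanishes)
    where
    coefficients = coefficientwise (trans (sym (mulQuad (- ν) 0# 1# g₀ g₁ g₂)) (trans eq (mulQuad h₀ h₁ h₂ k₀ k₁ k₂)))
    e₀ = proj₁ coefficients
    e₁ = proj₁ (proj₂ coefficients)
    e₂ = proj₁ (proj₂ (proj₂ coefficients))
    e₃ = proj₁ (proj₂ (proj₂ (proj₂ coefficients)))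
    e₄ = proj₂ (proj₂ (proj₂ (proj₂ coefficients)))
    product-vanishes : ⟪ h₀ + ν * h₂ , h₁ ⟫ L.* ⟪ k₀ + ν * k₂ , k₁ ⟫ ≡ L.0#
    product-vanishes = begin
      ⟪ h₀ + ν * h₂ , h₁ ⟫ L.* ⟪ k₀ + ν * k₂ , k₁ ⟫  ≡⟨ ⟪⟫-* _ _ _ _ ⟩
      ⟪ (h₀ + ν * h₂) * (k₀ + ν * k₂) + ν * (h₁ * k₁) , (h₀ + ν * h₂) * k₁ + h₁ * (k₀ + ν * k₂) ⟫
        ≡⟨ cong₂ ⟪_,_⟫
          -- The weights 1, ν, ν² are ρ⁰, ρ², ρ⁴, up to the sign required by the certificate; the
          -- odd coefficients give the ρ-coordinate in the same way.
          (linear-combination₃ (- 1#) e₀ (- ν) e₂ (- (ν * ν)) e₄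
            (solve 10 (λ g₀ g₁ g₂ h₀ h₁ h₂ k₀ k₁ k₂ n → let o = con (ℤ.+ 1) ; z = con (ℤ.+ 0) in
              ((h₀ :+ n :* h₂) :* (k₀ :+ n :* k₂) :+ n :* (h₁ :* k₁)) :- z :=
              (:- o) :* ((:- n) :* g₀ :- h₀ :* k₀) :+
              (:- n) :* ((:- n) :* g₂ :+ z :* g₁ :+ o :* g₀ :- (h₀ :* k₂ :+ h₁ :* k₁ :+ h₂ :* k₀)) :+
              (:- (n :* n)) :* (o :* g₂ :- h₂ :* k₂)) refl g₀ g₁ g₂ h₀ h₁ h₂ k₀ k₁ k₂ ν))
          (linear-combination₂ (- 1#) e₁ (- ν) e₃
            (solve 10 (λ g₀ g₁ g₂ h₀ h₁ h₂ k₀ k₁ k₂ n → let o = con (ℤ.+ 1) ; z = con (ℤ.+ 0) in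
              ((h₀ :+ n :* h₂) :* k₁ :+ h₁ :* (k₀ :+ n :* k₂)) :- z :=
              (:- o) :* ((:- n) :* g₁ :+ z :* g₀ :- (h₀ :* k₁ :+ h₁ :* k₀)) :+
              (:- n) :* (z :* g₂ :+ o :* g₁ :- (h₁ :* k₂ :+ h₂ :* k₁))) refl g₀ g₁ g₂ h₀ h₁ h₂ k₀ k₁ k₂ ν)) ⟩
      ⟪ 0# , 0# ⟫                                    ≡⟨ emb-as-⟪⟫ 0# ⟨
      emb 0#                                         ≡⟨ emb-0 ⟩
      L.0#                                           ∎

  -- Equality of the invariant ratios, cross-multiplied. The scalar `e` is absorbed into one factor,
  -- so numerator and denominator both acquire e² and the fourth power of the determinant.
  orbit-invariant : ∀ {a b c d e} g g′ → Quadratic g → Quadratic g′ →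
    mulP x²-ν g′ ≡ scale e (substForm a b c d (mulP x²-ν g)) →
    polar x²-ν g′ * polar x²-ν g′ * (disc x²-ν * disc g) ≡ polar x²-ν g * polar x²-ν g * (disc x²-ν * disc g′)
  orbit-invariant {a} {b} {c} {d} {e} g@(g₀ ∷ g₁ ∷ g₂ ∷ []) g′ refl g′-quadratic eq = begin
      P′ * P′ * (D₀ * D)
        ≡⟨ cong (λ t → t * t * (D₀ * D)) P′≡ ⟩
      (e * (Δ² * P)) * (e * (Δ² * P)) * (D₀ * D)
        ≡⟨ solve 5 (λ e x p d₀ d → (e :* (x :* p)) :* (e :* (x :* p)) :* (d₀ :* d) :=
             p :* p :* (e :* e :* (x :* d₀) :* (x :* d))) refl e Δ² P D₀ D ⟩
      P * P * (e * e * (Δ² * D₀) * (Δ² * D))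
        ≡⟨ cong (P * P *_) D₀D′≡ ⟨
      P * P * (D₀ * disc g′)
        ∎
    where
    P = polar x²-ν g
    P′ = polar x²-ν g′
    D₀ = disc x²-ν
    D = disc g
    Δ² = (a * d - b * c) * (a * d - b * c)
    s₀ = substForm a b c d x²-ν
    s = substForm a b c d g
    factored : mulP x²-ν g′ ≡ mulP (scale e s₀) s
    factored = trans eq (trans (cong (scale e) (substForm-mulP a b c d (- ν) 0# 1# g₀ g₁ g₂)) (sym (mulP-scaleˡ e s₀ s)))
    invariants = factorization-invariants g′ (scale e s₀) s g′-quadratic refl refl factored
    P′≡ : P′ ≡ e * (Δ² * P)
    P′≡ = trans (proj₁ invariants) (trans (polar-scaleˡ e s₀ s refl refl) (cong (e *_) (polar-substForm a b c d x²-ν g refl refl)))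
    D₀D′≡ : D₀ * disc g′ ≡ e * e * (Δ² * D₀) * (Δ² * D)
    D₀D′≡ = trans (proj₂ invariants) (cong₂ _*_
      (trans (disc-scale e s₀ refl) (cong (e * e *_) (polar-substForm a b c d x²-ν x²-ν refl refl)))
      (polar-substForm a b c d g g refl refl))

  -- The coordinate w and the elements of S₂₂

  -- The inverse of s ↦ (ρ+s)/(ρ-s); the element `s i` of the statement is by definition
  -- `cayley (ζ L.^ i)`.
  cayley : L.Carrier → L.Carrier
  cayley w = ρ L.* (w L.- L.1#) L.* ((w L.+ L.1#) L.⁻¹)

  -- The condition N(w) ≠ 1 excludes both the pole w = -1 and the values of `cayley` lying in K.
  module Cayley (w : L.Carrier) (Nw≢1 : N w ≢ 1#) where
    private
      p = re w
      r = im w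
    x = re (cayley w)
    y = im (cayley w)
    M = norm (p + 1#) r

    w+1≢0 : w L.+ L.1# ≢ L.0#
    w+1≢0 w+1≡0 = Nw≢1 (begin
      N w                ≡⟨ cong N (RingProperties.+-inverseˡ-unique L.ring w L.1# w+1≡0) ⟩
      N (L.- L.1#)       ≡⟨ cong (λ t → N (L.- t)) emb-1 ⟨
      N (L.- emb 1#)     ≡⟨ cong N (emb-neg 1#) ⟨
      N (emb (- 1#))     ≡⟨ N-emb (- 1#) ⟩
      - 1# * - 1#        ≡⟨ solve 0 ((:- con (ℤ.+ 1)) :* (:- con (ℤ.+ 1)) := con (ℤ.+ 1)) refl ⟩
      1#                 ∎)

    cayley-equation : cayley w L.* (w L.+ L.1#) ≡ ρ L.* (w L.- L.1#)
    cayley-equation = L.*/-cancel w+1≢0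

    private
      1-as-⟪⟫ : L.1# ≡ ⟪ 1# , 0# ⟫
      1-as-⟪⟫ = trans (sym emb-1) (emb-as-⟪⟫ 1#)

      equations = ⟪⟫-injective (begin
        ⟪ x * (p + 1#) + ν * (y * (r + 0#)) , x * (r + 0#) + y * (p + 1#) ⟫   ≡⟨ ⟪⟫-* _ _ _ _ ⟨
        ⟪ x , y ⟫ L.* ⟪ p + 1# , r + 0# ⟫        ≡⟨ cong (⟪ x , y ⟫ L.*_) (⟪⟫-+ p r 1# 0#) ⟨
        ⟪ x , y ⟫ L.* (⟪ p , r ⟫ L.+ ⟪ 1# , 0# ⟫)
          ≡⟨ cong₂ L._*_ (⟪re,im⟫ (cayley w)) (cong₂ L._+_ (⟪re,im⟫ w) 1-as-⟪⟫) ⟨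
        cayley w L.* (w L.+ L.1#)                ≡⟨ cayley-equation ⟩
        ρ L.* (w L.- L.1#)
          ≡⟨ cong₂ L._*_ ρ-as-⟪⟫ (cong₂ L._+_ (⟪re,im⟫ w) (trans (cong L.-_ 1-as-⟪⟫) (⟪⟫-neg 1# 0#))) ⟩
        ⟪ 0# , 1# ⟫ L.* (⟪ p , r ⟫ L.+ ⟪ - 1# , - 0# ⟫)  ≡⟨ cong (⟪ 0# , 1# ⟫ L.*_) (⟪⟫-+ p r (- 1#) (- 0#)) ⟩
        ⟪ 0# , 1# ⟫ L.* ⟪ p - 1# , r - 0# ⟫      ≡⟨ ⟪⟫-* _ _ _ _ ⟩
        ⟪ 0# * (p - 1#) + ν * (1# * (r - 0#)) , 0# * (r - 0#) + 1# * (p - 1#) ⟫  ∎)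

    abstract
      M≢0 : M ≢ 0#
      M≢0 M≡0 = let p+1≡0 , r≡0 = norm≡0 M≡0 in Nw≢1
        (linear-combination₂ (p - 1#) p+1≡0 (- (ν * r)) r≡0
          (solve 3 (λ p r n → let o = con (ℤ.+ 1) ; z = con (ℤ.+ 0) in
            (p :* p :- n :* (r :* r)) :- o := (p :- o) :* (p :+ o :- z) :+ (:- (n :* r)) :* (r :- z)) refl p r ν))

      -- `M` is the norm of w+1, so s = ρ(w-1)(w̄+1)/M, and (w-1)(w̄+1) = (N(w)-1) + 2rρ. The two
      -- coordinates of sM are this equation and the next.
      xM≡2νr : x * M ≡ two * (ν * r)
      xM≡2νr = linear-combination₂ (p + 1#) (proj₁ equations) (- (ν * r)) (proj₂ equations)
        (solve 5 (λ x y p r n → let o = con (ℤ.+ 1) ; z = con (ℤ.+ 0) in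
          x :* ((p :+ o) :* (p :+ o) :- n :* (r :* r)) :- con (ℤ.+ 2) :* (n :* r) :=
          (p :+ o) :* (x :* (p :+ o) :+ n :* (y :* (r :+ z)) :- (z :* (p :- o) :+ n :* (o :* (r :- z)))) :+
          (:- (n :* r)) :* (x :* (r :+ z) :+ y :* (p :+ o) :- (z :* (r :- z) :+ o :* (p :- o)))) refl x y p r ν)

      yM≡N-1 : y * M ≡ N w - 1#
      yM≡N-1 = linear-combination₂ (- r) (proj₁ equations) (p + 1#) (proj₂ equations)
        (solve 5 (λ x y p r n → let o = con (ℤ.+ 1) ; z = con (ℤ.+ 0) in
          y :* ((p :+ o) :* (p :+ o) :- n :* (r :* r)) :- ((p :* p :- n :* (r :* r)) :- o) :=
          (:- r) :* (x :* (p :+ o) :+ n :* (y :* (r :+ z)) :- (z :* (p :- o) :+ n :* (o :* (r :- z)))) :+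
          (p :+ o) :* (x :* (r :+ z) :+ y :* (p :+ o) :- (z :* (r :- z) :+ o :* (p :- o)))) refl x y p r ν)

      -- Conceptually N(s) = -νN(w-1)/N(w+1), and N(w-1)+N(w+1) = 2(N(w)+1). The left side carries
      -- the polar form of x²-νy² and `quad x y`, up to the factor -2.
      [n-ν]M≡-2ν[N+1] : (norm x y - ν) * M ≡ - (two * (ν * (N w + 1#)))
      [n-ν]M≡-2ν[N+1] = *-cancelˡ M≢0 (linear-combination₂ (x * M + two * (ν * r)) xM≡2νr
        (- (ν * (y * M + (N w - 1#)))) yM≡N-1
        (solve 5 (λ x y p r n → let o = con (ℤ.+ 1) ; t = con (ℤ.+ 2) ; N = p :* p :- n :* (r :* r)
                                    m = (p :+ o) :* (p :+ o) :- n :* (r :* r) in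
          m :* ((x :* x :- n :* (y :* y) :- n) :* m) :- m :* (:- (t :* (n :* (N :+ o)))) :=
          (x :* m :+ t :* (n :* r)) :* (x :* m :- t :* (n :* r)) :+
          (:- (n :* (y :* m :+ (N :- o)))) :* (y :* m :- (N :- o))) refl x y p r ν))

      y≢0 : y ≢ 0#
      y≢0 y≡0 = Nw≢1 (linear-combination₂ (- 1#) yM≡N-1 M y≡0
        (solve 3 (λ y m N → let o = con (ℤ.+ 1) in N :- o := (:- o) :* (y :* m :- (N :- o)) :+ m :* (y :- con (ℤ.+ 0))) refl y M (N w)))

      -- Equality would mean s = ±ρ, that is, w = 0 or w = ∞.
      quad≢x²-ν : N w ≢ 0# → x²-ν ≢ quad x y
      quad≢x²-ν Nw≢0 eq = Nw≢0 (trans (cong₂ norm p≡0 r≡0)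
          (solve 1 (λ n → con (ℤ.+ 0) :* con (ℤ.+ 0) :- n :* (con (ℤ.+ 0) :* con (ℤ.+ 0)) := con (ℤ.+ 0)) refl ν))
        where
        tail : ∀ {a b c a′ b′ c′ : Carrier} → _≡_ {A = List Carrier} (a ∷ b ∷ c ∷ []) (a′ ∷ b′ ∷ c′ ∷ []) → a ≡ a′ × b ≡ b′
        tail refl = refl , refl
        -ν≡n : - ν ≡ norm x y
        -ν≡n = proj₁ (tail eq)
        x≡0 : x ≡ 0#
        x≡0 = *-cancelˡ two≢0 (linear-combination₁ 1# (proj₂ (tail eq))
          (solve 1 (λ x → con (ℤ.+ 2) :* x :- con (ℤ.+ 2) :* con (ℤ.+ 0) :=
             con (ℤ.+ 1) :* (con (ℤ.+ 0) :- (:- (con (ℤ.+ 2) :* x)))) refl x))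
        r≡0 : r ≡ 0#
        r≡0 = *-cancelˡ (*-nonzero two≢0 ν≢0) (linear-combination₂ (- 1#) xM≡2νr M x≡0
          (solve 4 (λ x m r n → let z = con (ℤ.+ 0) in con (ℤ.+ 2) :* n :* r :- con (ℤ.+ 2) :* n :* z :=
             (:- con (ℤ.+ 1)) :* (x :* m :- con (ℤ.+ 2) :* (n :* r)) :+ m :* (x :- z)) refl x M r ν))
        -- N(s) = -ν turns the formula for (N(s)-ν)M into M = N(w)+1, whereas M = N(w)+1+2p.
        p≡0 : p ≡ 0#
        p≡0 = *-cancelˡ (*-nonzero (*-nonzero two≢0 two≢0) ν≢0) (linear-combination₂ (- 1#) [n-ν]M≡-2ν[N+1] (- M) -ν≡n
          (solve 4 (λ n′ p r n → let o = con (ℤ.+ 1) ; t = con (ℤ.+ 2) ; m = (p :+ o) :* (p :+ o) :- n :* (r :* r) in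
             t :* t :* n :* p :- t :* t :* n :* con (ℤ.+ 0) :=
             (:- o) :* ((n′ :- n) :* m :- (:- (t :* (n :* (p :* p :- n :* (r :* r) :+ o))))) :+
             (:- m) :* (:- n :- n′)) refl (norm x y) p r ν))

    minpoly : ∀ {h} → IsMinPoly (cayley w) h → h ≡ quad x y
    minpoly isMin = isMinPoly⇒quad y≢0 (subst (λ t → IsMinPoly t _) (⟪re,im⟫ (cayley w)) isMin)

    isMinPoly : IsMinPoly (cayley w) (quad x y)
    isMinPoly = subst (λ t → IsMinPoly t (quad x y)) (sym (⟪re,im⟫ (cayley w))) (quad-isMinPoly y≢0)

  polar-x²-ν : ∀ x y → polar x²-ν (quad x y) ≡ - (two * (norm x y - ν))
  polar-x²-ν x y = solve 3 (λ x m n → con (ℤ.+ 0) :* (:- (con (ℤ.+ 2) :* x)) :- con (ℤ.+ 2) :* ((:- n) :* con (ℤ.+ 1) :+ con (ℤ.+ 1) :* m) :=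
    :- (con (ℤ.+ 2) :* (m :- n))) refl x (norm x y) ν

  disc-x²-ν : disc x²-ν ≡ two * two * ν
  disc-x²-ν = solve 1 (λ n → con (ℤ.+ 0) :* con (ℤ.+ 0) :- con (ℤ.+ 2) :* ((:- n) :* con (ℤ.+ 1) :+ con (ℤ.+ 1) :* (:- n)) :=
    con (ℤ.+ 2) :* con (ℤ.+ 2) :* n) refl ν

  cayley-separates : ∀ {a b c d e} w w′ (Nw≢1 : N w ≢ 1#) (Nw′≢1 : N w′ ≢ 1#) →
    mulP x²-ν (quad (re (cayley w′)) (im (cayley w′))) ≡
      scale e (substForm a b c d (mulP x²-ν (quad (re (cayley w)) (im (cayley w))))) →
    N w ≡ N w′ ⊎ N w * N w′ ≡ 1#
  cayley-separates w w′ Nw≢1 Nw′≢1 eq =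
      [ inj₁ ∘ x-y≡0⇒x≡y , inj₂ ∘ x-y≡0⇒x≡y ]′ (zero-product (*-cancelˡ (*-nonzero t≢0 t≢0) vanishing))
    where
    module W = Cayley w Nw≢1
    module W′ = Cayley w′ Nw′≢1
    P = norm W.x W.y - ν
    P′ = norm W′.x W′.y - ν
    -- The factor t² = 1024ν⁴ collects 64ν² from Φ, 4ν² from squaring -2ν(k+1), and 4 from
    -- (k′+1)²(k-1)² - (k+1)²(k′-1)² = 4(k-k′)(kk′-1), where k = N(w) and k′ = N(w′).
    t = two * two * two * two * two * (ν * ν)
    t≢0 : t ≢ 0#
    t≢0 = *-nonzero (*-nonzero (*-nonzero (*-nonzero (*-nonzero two≢0 two≢0) two≢0) two≢0) two≢0) (*-nonzero ν≢0 ν≢0)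
    Φ : Carrier → Carrier → Carrier
    Φ u v = two * two * two * two * two * two * (ν * ν) * ((u * u) * (v * v))
    equal-invariants : (- (two * P′) * - (two * P′)) * (two * two * ν * (ν * ((two * W.y) * (two * W.y)))) ≡
                       (- (two * P) * - (two * P)) * (two * two * ν * (ν * ((two * W′.y) * (two * W′.y))))
    equal-invariants = begin
      (- (two * P′) * - (two * P′)) * (two * two * ν * (ν * ((two * W.y) * (two * W.y))))
        ≡⟨ cong₂ (λ u v → (u * u) * v) (polar-x²-ν W′.x W′.y) (cong₂ _*_ disc-x²-ν (disc-quad W.x W.y)) ⟨
      polar x²-ν (quad W′.x W′.y) * polar x²-ν (quad W′.x W′.y) * (disc x²-ν * disc (quad W.x W.y))
        ≡⟨ orbit-invariant (quad W.x W.y) (quad W′.x W′.y) refl refl eq ⟩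
      polar x²-ν (quad W.x W.y) * polar x²-ν (quad W.x W.y) * (disc x²-ν * disc (quad W′.x W′.y))
        ≡⟨ cong₂ (λ u v → (u * u) * v) (polar-x²-ν W.x W.y) (cong₂ _*_ disc-x²-ν (disc-quad W′.x W′.y)) ⟩
      (- (two * P) * - (two * P)) * (two * two * ν * (ν * ((two * W′.y) * (two * W′.y))))
        ∎
    -- Multiplied by (M M′)², the invariants become polynomials in N w and N w′.
    vanishing : t * t * ((N w - N w′) * (N w * N w′ - 1#)) ≡ t * t * 0#
    vanishing = begin
      t * t * ((N w - N w′) * (N w * N w′ - 1#))
        ≡⟨ solve 3 (λ k k′ n → let o = con (ℤ.+ 1) ; c = con (ℤ.+ 2) ; t = c :* c :* c :* c :* c :* (n :* n)
                                   F u v = c :* c :* c :* c :* c :* c :* (n :* n) :* ((u :* u) :* (v :* v)) in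
             t :* t :* ((k :- k′) :* (k :* k′ :- o)) :=
             F (:- (c :* (n :* (k′ :+ o)))) (k :- o) :- F (:- (c :* (n :* (k :+ o)))) (k′ :- o)) refl (N w) (N w′) ν ⟩
      Φ (- (two * (ν * (N w′ + 1#)))) (N w - 1#) - Φ (- (two * (ν * (N w + 1#)))) (N w′ - 1#)
        ≡⟨ cong₂ _-_ (cong₂ Φ W′.[n-ν]M≡-2ν[N+1] W.yM≡N-1) (cong₂ Φ W.[n-ν]M≡-2ν[N+1] W′.yM≡N-1) ⟨
      Φ (P′ * W′.M) (W.y * W.M) - Φ (P * W.M) (W′.y * W′.M)
        ≡⟨ solve 7 (λ p p′ m m′ y y′ n → let c = con (ℤ.+ 2)
                                             F u v = c :* c :* c :* c :* c :* c :* (n :* n) :* ((u :* u) :* (v :* v)) in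
             F (p′ :* m′) (y :* m) :- F (p :* m) (y′ :* m′) :=
             (m :* m′) :* (m :* m′) :*
               ((:- (c :* p′) :* :- (c :* p′)) :* (c :* c :* n :* (n :* ((c :* y) :* (c :* y)))) :-
                (:- (c :* p) :* :- (c :* p)) :* (c :* c :* n :* (n :* ((c :* y′) :* (c :* y′))))))
             refl P P′ W.M W′.M W.y W′.y ν ⟩
      (W.M * W′.M) * (W.M * W′.M) *
        ((- (two * P′) * - (two * P′)) * (two * two * ν * (ν * ((two * W.y) * (two * W.y)))) -
         (- (two * P) * - (two * P)) * (two * two * ν * (ν * ((two * W′.y) * (two * W′.y)))))
        ≡⟨ multiple-of-zero _ equal-invariants ⟩
      0#
        ≡⟨ zeroʳ (t * t) ⟨
      t * t * 0#
        ∎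

  -- Moving roots by the stabilizer of ρ

  -- The norm of cα+d for α = x+yρ outside K: if it vanished, then c = d = 0 by independence of 1
  -- and ρ.
  denominator≢0 : ∀ {a b c d x y} → a * d - b * c ≢ 0# → y ≢ 0# → norm (c * x + d) (c * y) ≢ 0#
  denominator≢0 {a} {b} {c} {d} {x} {y} det≢0 y≢0 norm≡ = det≢0 (linear-combination₂ a (proj₁ zeros) (- (a * x + b)) c≡0
      (solve 5 (λ a b c d x → let z = con (ℤ.+ 0) in (a :* d :- b :* c) :- z :=
        a :* (c :* x :+ d :- z) :+ (:- (a :* x :+ b)) :* (c :- z)) refl a b c d x))
    where
    zeros = norm≡0 norm≡
    c≡0 : c ≡ 0#
    c≡0 = [ (λ c≡0 → c≡0) , (λ y≡0 → ⊥-elim (y≢0 y≡0)) ]′ (zero-product (proj₂ zeros))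

  emb-*-⟪⟫ : ∀ a x y → emb a L.* ⟪ x , y ⟫ ≡ ⟪ a * x , a * y ⟫
  emb-*-⟪⟫ a x y = trans (cong (L._* ⟪ x , y ⟫) (emb-as-⟪⟫ a)) (trans (⟪⟫-* a 0# x y) (cong₂ ⟪_,_⟫
    (solve 4 (λ a x y n → a :* x :+ n :* (con (ℤ.+ 0) :* y) := a :* x) refl a x y ν)
    (solve 3 (λ a x y → a :* y :+ con (ℤ.+ 0) :* x := a :* y) refl a x y)))

  -- By Hilbert 90 the quotient of the coordinates of cayley w and X + Yρ, having norm 1, is v/v̄ with v = a+bρ.
  stabilizer-moves : ∀ {X Y} w → N w ≢ 1# → norm X (1# + Y) ≢ 0# → N w * norm X (1# - Y) ≡ norm X (1# + Y) →
    let s = cayley w in ∃[ a ] ∃[ b ] norm a b ≢ 0# ×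
      a * X + b * ν ≡ re s * (b * X + a) + ν * (im s * (b * Y)) ×
      a * Y ≡ re s * (b * Y) + im s * (b * X + a)
  stabilizer-moves {X} {Y} w Nw≢1 n₊≢0 ratio = a , b , norm-ab≢0 (proj₁ (proj₂ (proj₂ hilbert))) , moves
    where
    open Cayley w Nw≢1
    β = ⟪ X , Y ⟫
    ρ+β≡ : ρ L.+ β ≡ ⟪ 0# + X , 1# + Y ⟫
    ρ+β≡ = trans (cong (L._+ β) ρ-as-⟪⟫) (⟪⟫-+ 0# 1# X Y)
    ρ-β≡ : ρ L.- β ≡ ⟪ 0# - X , 1# - Y ⟫
    ρ-β≡ = trans (cong₂ L._+_ ρ-as-⟪⟫ (⟪⟫-neg X Y)) (⟪⟫-+ 0# 1# (- X) (- Y))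
    N₊ : N (ρ L.+ β) ≡ norm X (1# + Y)
    N₊ = trans (N-⟪⟫ ρ+β≡) (cong (λ t → norm t (1# + Y)) (+-identityˡ X))
    N₋ : N (ρ L.- β) ≡ norm X (1# - Y)
    N₋ = trans (N-⟪⟫ ρ-β≡) (solve 3 (λ x y n → (con (ℤ.+ 0) :- x) :* (con (ℤ.+ 0) :- x) :- n :* (y :* y) :=
           x :* x :- n :* (y :* y)) refl X (1# - Y) ν)
    ρ+β≢0 : ρ L.+ β ≢ L.0#
    ρ+β≢0 eq = n₊≢0 (trans (sym N₊) (trans (cong N (trans eq (sym emb-0))) (trans (N-emb 0#) (zeroˡ 0#))))
    -- The factor by which the coordinate of β must be multiplied to become w; `ratio` says exactly
    -- that its norm is 1.
    u = w L.* (ρ L.- β) L.* ((ρ L.+ β) L.⁻¹)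
    u[ρ+β]≡ : u L.* (ρ L.+ β) ≡ w L.* (ρ L.- β)
    u[ρ+β]≡ = L.*/-cancel ρ+β≢0
    Nu≡1 : N u ≡ 1#
    Nu≡1 = *-cancelˡ n₊≢0 (begin
      norm X (1# + Y) * N u        ≡⟨ *-comm _ _ ⟩
      N u * norm X (1# + Y)        ≡⟨ cong (N u *_) N₊ ⟨
      N u * N (ρ L.+ β)            ≡⟨ N-* u (ρ L.+ β) ⟨
      N (u L.* (ρ L.+ β))          ≡⟨ cong N u[ρ+β]≡ ⟩
      N (w L.* (ρ L.- β))          ≡⟨ N-* w (ρ L.- β) ⟩
      N w * N (ρ L.- β)            ≡⟨ cong (N w *_) N₋ ⟩
      N w * norm X (1# - Y)        ≡⟨ ratio ⟩
      norm X (1# + Y)              ≡⟨ *-identityʳ _ ⟨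
      norm X (1# + Y) * 1#         ∎)
    hilbert = hilbert90 Nu≡1
    a = proj₁ hilbert
    b = proj₁ (proj₂ hilbert)
    norm-ab≢0 : (a ≡ 0# × b ≡ 1#) ⊎ a ≡ 1# → norm a b ≢ 0#
    norm-ab≢0 (inj₁ (_ , b≡1)) eq = 0≢1 (trans (sym (proj₂ (norm≡0 eq))) b≡1)
    norm-ab≢0 (inj₂ a≡1)       eq = 0≢1 (trans (sym (proj₁ (norm≡0 eq))) a≡1)
    möbius : emb a L.* β L.+ emb b L.* (ρ L.* ρ) ≡ cayley w L.* (emb b L.* β L.+ emb a)
    möbius = L.möbius-coordinate (begin
        w L.* (ρ L.- β) L.* (emb a L.- emb b L.* ρ)
          ≡⟨ cong₂ L._*_ (sym u[ρ+β]≡) (trans (L.neg-product (emb a) (emb b) ρ) (cong (λ t → emb a L.+ t L.* ρ) (sym (emb-neg b)))) ⟩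
        u L.* (ρ L.+ β) L.* ⟪ a , - b ⟫          ≡⟨ cong (L._* ⟪ a , - b ⟫) (L.*-comm u (ρ L.+ β)) ⟩
        (ρ L.+ β) L.* u L.* ⟪ a , - b ⟫          ≡⟨ L.*-assoc (ρ L.+ β) u _ ⟩
        (ρ L.+ β) L.* (u L.* ⟪ a , - b ⟫)        ≡⟨ cong ((ρ L.+ β) L.*_) (proj₂ (proj₂ (proj₂ hilbert))) ⟩
        (ρ L.+ β) L.* ⟪ a , b ⟫                  ∎) cayley-equation w+1≢0
    moves : a * X + b * ν ≡ x * (b * X + a) + ν * (y * (b * Y)) × a * Y ≡ x * (b * Y) + y * (b * X + a)
    moves = let re≡ , im≡ = ⟪⟫-injective (begin
                  ⟪ a * X + b * ν , a * Y + 0# ⟫              ≡⟨ ⟪⟫-+ _ _ _ _ ⟨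
                  ⟪ a * X , a * Y ⟫ L.+ ⟪ b * ν , 0# ⟫        ≡⟨ cong₂ L._+_ (emb-*-⟪⟫ a X Y)
                                                                   (trans (cong (emb b L.*_) (sym ν≡ρ²)) (trans (sym (emb-* b ν)) (emb-as-⟪⟫ (b * ν)))) ⟨
                  emb a L.* β L.+ emb b L.* (ρ L.* ρ)         ≡⟨ möbius ⟩
                  cayley w L.* (emb b L.* β L.+ emb a)        ≡⟨ cong₂ L._*_ (⟪re,im⟫ (cayley w))
                                                                   (trans (cong₂ L._+_ (emb-*-⟪⟫ b X Y) (emb-as-⟪⟫ a)) (⟪⟫-+ _ _ _ _)) ⟩
                  ⟪ x , y ⟫ L.* ⟪ b * X + a , b * Y + 0# ⟫    ≡⟨ ⟪⟫-* _ _ _ _ ⟩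
                  ⟪ x * (b * X + a) + ν * (y * (b * Y + 0#)) , x * (b * Y + 0#) + y * (b * X + a) ⟫  ∎)
            in trans re≡ (cong (λ t → x * (b * X + a) + ν * (y * t)) (+-identityʳ (b * Y))) ,
               trans (sym (+-identityʳ (a * Y))) (trans im≡ (cong (λ t → x * t + y * (b * X + a)) (+-identityʳ (b * Y))))

  -- Orbits and their representatives

  module Classification (ζ : El L) (generates : Generator L ζ) where
    open NormOfGenerator ζ generates
    open Setup ι ζ ρ

    half : ℕ
    half = (size ∸ 1) ℕ./ 2

    Representative : List Carrier → Set
    Representative f = ∃[ g ] (InT22 g × f ≡ mulP x²-ν g)

    -- γⁱ = 1 would give q-1 ≤ i ≤ `half`, although 2·`half` ≤ q-1 and `half` > 0.
    N[ζ^i]≢1 : ∀ {i} → 1 ℕ.≤ i → i ℕ.≤ half → N (ζ L.^ i) ≢ 1#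
    N[ζ^i]≢1 {i} 1≤i i≤half eq = ℕₚ.<⇒≱ (ℕₚ.+-mono-≤ 1≤i (ℕₚ.≤-refl {half}))
      (ℕₚ.≤-trans (ℕₚ.+-monoˡ-≤ half i≤half) (ℕₚ.≤-trans (n/2+n/2≤n (size ∸ 1))
        (ℕₚ.≤-trans (γ-order 1≤i (trans (sym (N-^ ζ i)) eq)) i≤half)))

    quad-factor : ∀ {b c w} → b * b - two * two * c ≡ w * w →
      c ∷ b ∷ 1# ∷ [] ≡ mulP ((b - w) * two ⁻¹ ∷ 1# ∷ []) ((b + w) * two ⁻¹ ∷ 1# ∷ [])
    quad-factor {b} {c} {w} D≡w² = list-cong₃
      (linear-combination₂ (- (two ⁻¹ * two ⁻¹)) D≡w² (- (c * (two * two ⁻¹ + 1#))) (⁻¹-inverse two two≢0)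
        (solve 4 (λ b c w d → let t = con (ℤ.+ 2) in c :- ((b :- w) :* d :* ((b :+ w) :* d) :+ con (ℤ.+ 0)) :=
           (:- (d :* d)) :* (b :* b :- t :* t :* c :- w :* w) :+
           (:- (c :* (t :* d :+ con (ℤ.+ 1)))) :* (t :* d :- con (ℤ.+ 1))) refl b c w (two ⁻¹)))
      (linear-combination₁ (- b) (⁻¹-inverse two two≢0)
        (solve 3 (λ b w d → let t = con (ℤ.+ 2) ; o = con (ℤ.+ 1) in
           b :- ((b :- w) :* d :* o :+ (o :* ((b :+ w) :* d) :+ con (ℤ.+ 0))) := (:- b) :* (t :* d :- o)) refl b w (two ⁻¹)))
      (sym (*-identityˡ 1#))

    complete-square : ∀ {b c y} → b * b - two * two * c ≡ ν * (y * y) → c ∷ b ∷ 1# ∷ [] ≡ quad (- (b * two ⁻¹)) (y * two ⁻¹)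
    complete-square {b} {c} {y} D≡νy² = list-cong₃
      (linear-combination₂ (- (two ⁻¹ * two ⁻¹)) D≡νy² (- (c * (two * two ⁻¹ + 1#))) (⁻¹-inverse two two≢0)
        (solve 5 (λ b c y d n → let t = con (ℤ.+ 2) in
           c :- ((:- (b :* d)) :* (:- (b :* d)) :- n :* (y :* d :* (y :* d))) :=
           (:- (d :* d)) :* (b :* b :- t :* t :* c :- n :* (y :* y)) :+
           (:- (c :* (t :* d :+ con (ℤ.+ 1)))) :* (t :* d :- con (ℤ.+ 1))) refl b c y (two ⁻¹) ν))
      (linear-combination₁ (- b) (⁻¹-inverse two two≢0)
        (solve 2 (λ b d → let t = con (ℤ.+ 2) in
           b :- (:- (t :* (:- (b :* d)))) := (:- b) :* (t :* d :- con (ℤ.+ 1))) refl b (two ⁻¹)))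
      refl

    -- The discriminant b²-4c is a square, and the form splits, or it is νy², and completing the
    -- square gives the root -b/2 + (y/2)ρ.
    monic-irreducible⇒quad : ∀ g → MonicForm g → IrreducibleQuadratic g → ∃[ x ] ∃[ y ] y ≢ 0# × g ≡ quad x y
    monic-irreducible⇒quad (c ∷ b ∷ a ∷ []) monic (refl , irreducible) =
        -- A monic form may have x²-coefficient 0; then the form y, with coefficients
        -- `1# ∷ 0# ∷ []`, divides it.
        [ (λ { refl → ⊥-elim (irreducible (1# ∷ 0# ∷ []) (c ∷ b ∷ []) refl refl (list-cong₃
              (sym (trans (+-identityʳ _) (*-identityˡ c)))
              (solve 2 (λ b c → b := con (ℤ.+ 1) :* b :+ (con (ℤ.+ 0) :* c :+ con (ℤ.+ 0))) refl b c)
              (sym (zeroˡ b)))) })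
        , (λ { refl → [ (λ { (w , D≡w²) → ⊥-elim (irreducible ((b - w) * two ⁻¹ ∷ 1# ∷ []) ((b + w) * two ⁻¹ ∷ 1# ∷ []) refl refl (quad-factor D≡w²)) })
                      , (λ { (y , y≢0 , D≡νy²) → _ , _ , *-nonzero y≢0 (⁻¹-nonzero two≢0) , complete-square D≡νy² })
                      ]′ (square-or-ν-square (b * b - two * two * c)) })
        ]′ (leading monic)
      where
      leading : MonicForm (c ∷ b ∷ a ∷ []) → a ≡ 0# ⊎ a ≡ 1#
      leading ([]            , _ , (_ ∷ a≡0 ∷ []) , refl) = inj₁ a≡0
      leading (_ ∷ []        , _ , (a≡0 ∷ [])     , refl) = inj₁ a≡0
      leading (_ ∷ _ ∷ []    , _ , []             , refl) = inj₂ refl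
      leading (_ ∷ _ ∷ _ ∷ []    , _ , _ , ())
      leading (_ ∷ _ ∷ _ ∷ _ ∷ _ , _ , _ , ())

    representatives-valid : ∀ r → Representative r → TwoQuadQuartic r
    representatives-valid r (g , (i , 1≤i , i≤half , _ , isMin , refl) , r≡) =
        subst TwoQuadQuartic (sym (trans r≡ (cong (mulP x²-ν) (minpoly isMin))))
          (refl , x²-ν , quad x y , (- ν ∷ 0# ∷ [] , [] , [] , refl) ,
           subst IrreducibleQuadratic (sym x²-ν≡quad) (quad-irreducible 0# (0≢1 ∘ sym)) ,
           quad-monic x y , quad-irreducible x y≢0 ,
           quad≢x²-ν (N-nonzero (L.^-nonzero i ζ≢0)) , refl)
      where open Cayley (ζ L.^ i) (N[ζ^i]≢1 1≤i i≤half)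

    γ^-distinct-upto-half : ∀ {i j} → 1 ℕ.≤ i → i ℕ.< j → j ℕ.≤ half → γ ^ i ≢ γ ^ j
    γ^-distinct-upto-half 1≤i i<j j≤half = γ^-distinct i<j
      (ℕₚ.<-≤-trans (ℕₚ.∸-monoʳ-< 1≤i (ℕₚ.<⇒≤ i<j)) (ℕₚ.≤-trans j≤half (ℕₚ.≤-trans (ℕₚ.m≤m+n half half) (n/2+n/2≤n (size ∸ 1)))))

    exponents-equal : ∀ {i j} → 1 ℕ.≤ i → i ℕ.≤ half → 1 ℕ.≤ j → j ℕ.≤ half →
      N (ζ L.^ i) ≡ N (ζ L.^ j) ⊎ N (ζ L.^ i) * N (ζ L.^ j) ≡ 1# → i ≡ j
    exponents-equal {i} {j} 1≤i i≤half 1≤j j≤half (inj₁ eq) = compare (ℕₚ.<-cmp i j)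
      where
      γ^i≡γ^j : γ ^ i ≡ γ ^ j
      γ^i≡γ^j = trans (sym (N-^ ζ i)) (trans eq (N-^ ζ j))
      compare : Tri (i ℕ.< j) (i ≡ j) (i ℕ.> j) → i ≡ j
      compare (tri< i<j _ _) = ⊥-elim (γ^-distinct-upto-half 1≤i i<j j≤half γ^i≡γ^j)
      compare (tri≈ _ i≡j _) = i≡j
      compare (tri> _ _ j<i) = ⊥-elim (γ^-distinct-upto-half 1≤j j<i i≤half (sym γ^i≡γ^j))
    -- Here γ^(i+j) = 1 forces q-1 ≤ i+j, and both exponents are at most `half`, so both equal
    -- `half`.
    exponents-equal {i} {j} 1≤i i≤half 1≤j j≤half (inj₂ eq) =
        trans (ℕₚ.≤-antisym i≤half (ℕₚ.+-cancelʳ-≤ half half i (ℕₚ.≤-trans 2half≤i+j (ℕₚ.+-monoʳ-≤ i j≤half))))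
              (ℕₚ.≤-antisym (ℕₚ.+-cancelˡ-≤ half half j (ℕₚ.≤-trans 2half≤i+j (ℕₚ.+-monoˡ-≤ j i≤half))) j≤half)
      where
      2half≤i+j : half ℕ.+ half ℕ.≤ i ℕ.+ j
      2half≤i+j = ℕₚ.≤-trans (n/2+n/2≤n (size ∸ 1)) (γ-order (ℕₚ.≤-trans 1≤i (ℕₚ.m≤m+n i j))
        (trans (^-+ γ i j) (trans (sym (cong₂ _*_ (N-^ ζ i) (N-^ ζ j))) eq)))

    representatives-inequivalent : ∀ r r′ → Representative r → Representative r′ → SameOrbit r r′ → r ≡ r′
    representatives-inequivalent r r′ (g , (i , 1≤i , i≤half , _ , isMin , refl) , r≡) (g′ , (j , 1≤j , j≤half , _ , isMin′ , refl) , r′≡)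
        (a , b , c , d , _ , _ , e , _ , eq) =
        trans r≡quad (trans (cong (λ k → mulP x²-ν (quad (re (s k)) (im (s k)))) i≡j) (sym r′≡quad))
      where
      module W  = Cayley (ζ L.^ i) (N[ζ^i]≢1 1≤i i≤half)
      module W′ = Cayley (ζ L.^ j) (N[ζ^i]≢1 1≤j j≤half)
      r≡quad : r ≡ mulP x²-ν (quad W.x W.y)
      r≡quad = trans r≡ (cong (mulP x²-ν) (W.minpoly isMin))
      r′≡quad : r′ ≡ mulP x²-ν (quad W′.x W′.y)
      r′≡quad = trans r′≡ (cong (mulP x²-ν) (W′.minpoly isMin′))
      i≡j : i ≡ j
      i≡j = exponents-equal 1≤i i≤half 1≤j j≤half (cayley-separates (ζ L.^ i) (ζ L.^ j) (N[ζ^i]≢1 1≤i i≤half) (N[ζ^i]≢1 1≤j j≤half)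
        (trans (sym r′≡quad) (trans eq (cong (scale e ∘ substForm a b c d) r≡quad))))

    product-monic : ∀ x y → MonicForm (mulP x²-ν (quad x y))
    product-monic x y = _ ∷ _ ∷ _ ∷ _ ∷ [] , [] , [] ,
      trans (mulQuad (- ν) 0# 1# _ _ 1#) (list-cong₅ refl refl refl refl (*-identityˡ 1#))

    -- x ↦ (x−x₁)/y₁ moves x₁+y₁ρ to ρ; follow it by an element of the stabilizer of ρ.
    represent : ∀ {x₁ y₁ X Y i} → y₁ ≢ 0# → Y ≢ 0# → 1 ℕ.≤ i → i ℕ.≤ half →
      norm X (1# + Y) ≢ 0# → γ ^ i * norm X (1# - Y) ≡ norm X (1# + Y) →
      ∃[ r ] (Representative r × SameOrbit (mulP (quad x₁ y₁) (quad (x₁ + y₁ * X) (y₁ * Y))) r)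
    represent {x₁} {y₁} {X} {Y} {i} y₁≢0 Y≢0 1≤i i≤half n₊≢0 ratio =
        mulP x²-ν (quad x y) ,
        (quad x y , (i , 1≤i , i≤half , quad x y , isMinPoly , refl) , refl) ,
        -- The product of the stabilizer matrix [[a, bν], [b, a]] with the affine matrix [[1, -x₁],
        -- [0, y₁]]; its determinant is y₁ times `norm a b`.
        a , b * ν * y₁ - a * x₁ , b , a * y₁ - b * x₁ , det≢0 ,
        product-monic x y , (l₁ * l₂) ⁻¹ , ⁻¹-nonzero l₁l₂≢0 , sym moved
      where
      open Cayley (ζ L.^ i) (N[ζ^i]≢1 1≤i i≤half)
      stabilizer = stabilizer-moves {X} {Y} (ζ L.^ i) (N[ζ^i]≢1 1≤i i≤half) n₊≢0
        (trans (cong (_* norm X (1# - Y)) (N-^ ζ i)) ratio)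
      a = proj₁ stabilizer
      b = proj₁ (proj₂ stabilizer)
      B = b * ν * y₁ - a * x₁
      D = a * y₁ - b * x₁
      x₂ = x₁ + y₁ * X
      y₂ = y₁ * Y
      l₁ = norm (b * x₁ + D) (b * y₁)
      l₂ = norm (b * x₂ + D) (b * y₂)
      det≢0 : a * D - B * b ≢ 0#
      det≢0 eq = *-nonzero y₁≢0 (proj₁ (proj₂ (proj₂ stabilizer))) (trans
        (solve 5 (λ a b x₁ y₁ n → y₁ :* (a :* a :- n :* (b :* b)) :=
           a :* (a :* y₁ :- b :* x₁) :- (b :* n :* y₁ :- a :* x₁) :* b) refl a b x₁ y₁ ν) eq)
      l₁l₂≢0 : l₁ * l₂ ≢ 0#
      l₁l₂≢0 = *-nonzero (denominator≢0 det≢0 y₁≢0) (denominator≢0 det≢0 (*-nonzero y₁≢0 Y≢0))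
      moved₁ : substForm a B b D (quad x₁ y₁) ≡ scale l₁ x²-ν
      moved₁ = trans (substForm-quad {x′ = 0#} {y′ = 1#}
          (solve 5 (λ a b x₁ y₁ n → a :* x₁ :+ (b :* n :* y₁ :- a :* x₁) :=
             con (ℤ.+ 0) :* (b :* x₁ :+ (a :* y₁ :- b :* x₁)) :+ n :* (con (ℤ.+ 1) :* (b :* y₁))) refl a b x₁ y₁ ν)
          (solve 4 (λ a b x₁ y₁ → a :* y₁ := con (ℤ.+ 0) :* (b :* y₁) :+ con (ℤ.+ 1) :* (b :* x₁ :+ (a :* y₁ :- b :* x₁)))
             refl a b x₁ y₁))
        (cong (scale l₁) (sym x²-ν≡quad))
      moved₂ : substForm a B b D (quad x₂ y₂) ≡ scale l₂ (quad x y)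
      moved₂ = substForm-quad {x′ = x} {y′ = y}
        (linear-combination₁ y₁ (proj₁ (proj₂ (proj₂ (proj₂ stabilizer))))
          (solve 9 (λ a b x y X Y x₁ y₁ n → let x₂ = x₁ :+ y₁ :* X ; D = a :* y₁ :- b :* x₁ in
             a :* x₂ :+ (b :* n :* y₁ :- a :* x₁) :- (x :* (b :* x₂ :+ D) :+ n :* (y :* (b :* (y₁ :* Y)))) :=
             y₁ :* (a :* X :+ b :* n :- (x :* (b :* X :+ a) :+ n :* (y :* (b :* Y))))) refl a b x y X Y x₁ y₁ ν))
        (linear-combination₁ y₁ (proj₂ (proj₂ (proj₂ (proj₂ stabilizer))))
          (solve 8 (λ a b x y X Y x₁ y₁ → let x₂ = x₁ :+ y₁ :* X ; D = a :* y₁ :- b :* x₁ in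
             a :* (y₁ :* Y) :- (x :* (b :* (y₁ :* Y)) :+ y :* (b :* x₂ :+ D)) :=
             y₁ :* (a :* Y :- (x :* (b :* Y) :+ y :* (b :* X :+ a)))) refl a b x y X Y x₁ y₁))
      moved : scale ((l₁ * l₂) ⁻¹) (substForm a B b D (mulP (quad x₁ y₁) (quad x₂ y₂))) ≡ mulP x²-ν (quad x y)
      moved = begin
        scale ((l₁ * l₂) ⁻¹) (substForm a B b D (mulP (quad x₁ y₁) (quad x₂ y₂)))
          ≡⟨ cong (scale ((l₁ * l₂) ⁻¹)) (trans (substForm-mulP a B b D _ _ _ _ _ _) (cong₂ mulP moved₁ moved₂)) ⟩
        scale ((l₁ * l₂) ⁻¹) (mulP (scale l₁ x²-ν) (scale l₂ (quad x y)))
          ≡⟨ cong (scale ((l₁ * l₂) ⁻¹)) (trans (mulP-scaleˡ l₁ x²-ν (scale l₂ (quad x y)))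
               (trans (cong (scale l₁) (mulP-scaleʳ l₂ x²-ν (quad x y))) (scale-scale l₁ l₂ _))) ⟩
        scale ((l₁ * l₂) ⁻¹) (scale (l₁ * l₂) (mulP x²-ν (quad x y)))
          ≡⟨ scale-scale ((l₁ * l₂) ⁻¹) (l₁ * l₂) _ ⟩
        scale ((l₁ * l₂) ⁻¹ * (l₁ * l₂)) (mulP x²-ν (quad x y))
          ≡⟨ cong (λ t → scale t (mulP x²-ν (quad x y))) (trans (*-comm _ _) (⁻¹-inverse (l₁ * l₂) l₁l₂≢0)) ⟩
        scale 1# (mulP x²-ν (quad x y))
          ≡⟨ scale-1 _ ⟩
        mulP x²-ν (quad x y)
          ∎

    -- Replacing X+Yρ by its conjugate inverts the ratio of norms γᵏ, so k may be replaced by q−1−k.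
    represent-pair : ∀ {x₁ y₁ x₂ y₂} → y₁ ≢ 0# → y₂ ≢ 0# → quad x₁ y₁ ≢ quad x₂ y₂ →
      ∃[ r ] (Representative r × SameOrbit (mulP (quad x₁ y₁) (quad x₂ y₂)) r)
    represent-pair {x₁} {y₁} {x₂} {y₂} y₁≢0 y₂≢0 distinct = choose (k ℕ.≤? half)
      where
      X = (x₂ - x₁) * y₁ ⁻¹
      Y = y₂ * y₁ ⁻¹
      Y≢0 : Y ≢ 0#
      Y≢0 = *-nonzero y₂≢0 (⁻¹-nonzero y₁≢0)
      x₂≡ : x₁ + y₁ * X ≡ x₂
      x₂≡ = linear-combination₁ (x₂ - x₁) (⁻¹-inverse y₁ y₁≢0)
        (solve 4 (λ x₁ x₂ y₁ d → x₁ :+ y₁ :* ((x₂ :- x₁) :* d) :- x₂ := (x₂ :- x₁) :* (y₁ :* d :- con (ℤ.+ 1)))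
           refl x₁ x₂ y₁ (y₁ ⁻¹))
      y₂≡ : y₁ * Y ≡ y₂
      y₂≡ = trans (*-comm y₁ Y) (*/-cancel y₁≢0)
      quad₂≡ : quad (x₁ + y₁ * X) (y₁ * Y) ≡ quad x₂ y₂
      quad₂≡ = cong₂ quad x₂≡ y₂≡
      quad₂≡conjugate : quad (x₁ + y₁ * X) (y₁ * - Y) ≡ quad x₂ y₂
      quad₂≡conjugate = trans (cong₂ _∷_ (solve 4 (λ x y Y n → x :* x :- n :* ((y :* :- Y) :* (y :* :- Y)) :=
        x :* x :- n :* ((y :* Y) :* (y :* Y))) refl (x₁ + y₁ * X) y₁ Y ν) refl) quad₂≡
      n₊ = norm X (1# + Y)
      n₋ = norm X (1# - Y)
      x₁≡ : X ≡ 0# → x₁ ≡ x₁ + y₁ * X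
      x₁≡ X≡0 = linear-combination₁ (- y₁) X≡0
        (solve 3 (λ x y X → x :- (x :+ y :* X) := (:- y) :* (X :- con (ℤ.+ 0))) refl x₁ y₁ X)
      -- `n₋` and `n₊` are the norms of ρ-β and ρ+β for β = X+Yρ. If one vanished, the second root
      -- would be the first or its conjugate, and the two factors would coincide.
      n₋≢0 : n₋ ≢ 0#
      n₋≢0 eq = let X≡0 , 1-Y≡0 = norm≡0 eq in distinct (trans (cong₂ quad (x₁≡ X≡0)
        (linear-combination₁ y₁ 1-Y≡0 (solve 2 (λ y Y → y :- y :* Y := y :* (con (ℤ.+ 1) :- Y :- con (ℤ.+ 0))) refl y₁ Y))) quad₂≡)
      n₊≢0 : n₊ ≢ 0#
      n₊≢0 eq = let X≡0 , 1+Y≡0 = norm≡0 eq in distinct (trans (cong₂ quad (x₁≡ X≡0)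
        (linear-combination₁ y₁ 1+Y≡0 (solve 2 (λ y Y → y :- y :* :- Y := y :* (con (ℤ.+ 1) :+ Y :- con (ℤ.+ 0))) refl y₁ Y))) quad₂≡conjugate)
      power = γ-generates (*-nonzero n₊≢0 (⁻¹-nonzero n₋≢0))
      k = proj₁ power
      ratio : γ ^ k * n₋ ≡ n₊
      ratio = trans (cong (_* n₋) (sym (proj₂ (proj₂ power)))) (*/-cancel n₋≢0)
      -- For k = 0 the two norms agree, and their difference `n₋` - `n₊` is 4νY.
      k≢0 : k ≢ 0
      k≢0 k≡0 = *-nonzero (*-nonzero (*-nonzero two≢0 two≢0) ν≢0) Y≢0
        (linear-combination₁ 1# (trans (cong (λ t → γ ^ t * n₋) (sym k≡0)) ratio)
          (solve 3 (λ X Y n → let o = con (ℤ.+ 1) ; t = con (ℤ.+ 2) in t :* t :* n :* Y :- con (ℤ.+ 0) :=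
             o :* (o :* (X :* X :- n :* ((o :- Y) :* (o :- Y))) :- (X :* X :- n :* ((o :+ Y) :* (o :+ Y))))) refl X Y ν))
      k<q-1 = proj₁ (proj₂ power)
      ratio-conjugate : γ ^ (size ∸ 1 ∸ k) * norm X (1# - - Y) ≡ norm X (1# + - Y)
      ratio-conjugate = begin
        γ ^ (size ∸ 1 ∸ k) * norm X (1# - - Y)     ≡⟨ cong (λ t → γ ^ (size ∸ 1 ∸ k) * norm X t)
                                                       (solve 1 (λ Y → con (ℤ.+ 1) :- (:- Y) := con (ℤ.+ 1) :+ Y) refl Y) ⟩
        γ ^ (size ∸ 1 ∸ k) * n₊                    ≡⟨ cong (γ ^ (size ∸ 1 ∸ k) *_) ratio ⟨
        γ ^ (size ∸ 1 ∸ k) * (γ ^ k * n₋)          ≡⟨ *-assoc _ _ _ ⟨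
        γ ^ (size ∸ 1 ∸ k) * γ ^ k * n₋            ≡⟨ cong (_* n₋) (^-+ γ (size ∸ 1 ∸ k) k) ⟨
        γ ^ (size ∸ 1 ∸ k ℕ.+ k) * n₋              ≡⟨ cong (λ t → γ ^ t * n₋) (ℕₚ.m∸n+n≡m (ℕₚ.<⇒≤ k<q-1)) ⟩
        γ ^ (size ∸ 1) * n₋                        ≡⟨ cong (_* n₋) γ^[q-1]≡1 ⟩
        1# * n₋                                    ≡⟨ *-identityˡ n₋ ⟩
        n₋                                         ∎
      transport : ∀ {q} → q ≡ quad x₂ y₂ → ∃[ r ] (Representative r × SameOrbit (mulP (quad x₁ y₁) q) r) →
        ∃[ r ] (Representative r × SameOrbit (mulP (quad x₁ y₁) (quad x₂ y₂)) r)
      transport refl p = p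
      choose : Dec (k ℕ.≤ half) → ∃[ r ] (Representative r × SameOrbit (mulP (quad x₁ y₁) (quad x₂ y₂)) r)
      choose (yes k≤half) = transport quad₂≡ (represent y₁≢0 Y≢0 (ℕₚ.n≢0⇒n>0 k≢0) k≤half n₊≢0 ratio)
      choose (no  k≰half) = transport quad₂≡conjugate
        (represent y₁≢0 (Y≢0 ∘ neg≡0) (ℕₚ.m<n⇒0<n∸m k<q-1)
          -- q-1 ≤ 2·`half`+1 ≤ k+`half`, so the replaced exponent q-1-k is at most `half`.
          (ℕₚ.m≤n+o⇒m∸n≤o (size ∸ 1) k (ℕₚ.≤-trans (n≤1+n/2+n/2 (size ∸ 1)) (ℕₚ.+-monoˡ-≤ half (ℕₚ.≰⇒> k≰half))))
          n₋≢0 ratio-conjugate)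

    representatives-exhaustive : ∀ f → TwoQuadQuartic f → ∃[ r ] (Representative r × SameOrbit f r)
    representatives-exhaustive f (_ , g₁ , g₂ , monic₁ , irreducible₁ , monic₂ , irreducible₂ , g₁≢g₂ , f≡) =
      let x₁ , y₁ , y₁≢0 , g₁≡ = monic-irreducible⇒quad g₁ monic₁ irreducible₁
          x₂ , y₂ , y₂≢0 , g₂≡ = monic-irreducible⇒quad g₂ monic₂ irreducible₂
      in subst (λ f → ∃[ r ] (Representative r × SameOrbit f r)) (sym (trans f≡ (cong₂ mulP g₁≡ g₂≡)))
           (represent-pair y₁≢0 y₂≢0 (λ eq → g₁≢g₂ (trans g₁≡ (trans eq (sym g₂≡)))))

open import Data.Nat using (ℕ; _*_; _%_)

theorem3p4 : (K L : FiniteField) (ι : Embedding K L)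
    → card K % 2 ≡ 1
    → card L ≡ card K * card K
    → (ζ : El L) → Generator L ζ
    → (ρ : El L) → (∀ x → Embedding.emb ι x ≢ ρ)
    → (ν : El K) → Embedding.emb ι ν ≡ FiniteField._*_ L ρ ρ
    → Poly.CompleteReps K (Poly.TwoQuadQuartic K)
    (λ f → ∃[ g ] (Setup.InT22 ι ζ ρ g ×
    f ≡ Poly.mulP K (FiniteField.-_ K ν ∷ FiniteField.0# K ∷ FiniteField.1# K ∷ []) g))
theorem3p4 K L ι _ |L|≡|K|² ζ generates ρ ρ∉K ν ν≡ρ² =
    representatives-valid , representatives-exhaustive , representatives-inequivalent
  where
  open QuadraticExtension ι |L|≡|K|² ρ ρ∉K ν ν≡ρ²
  open Classification ζ generates
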